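{- For any integers $n,k$ with $2\le k\le\log_2\log_2 n$, there is a deterministic algorithm which, given a set $X$ of $n$ elements, sorts the elements of $X$ with error $k$ using at most $7\cdot 2^{2k}n^{1+2^{1-k}}+n\,c_n$ comparisons, where $c_n=\min\{\binom{n}{2},\binom{215}{2}\}$.
   Context: Model: each element $x_i$ has an unknown real value $\mathrm{val}(x_i)$. A comparator query on $x_i,x_j$ returns "$x_i\ge x_j$" or "$x_j\ge x_i$"; the answer is correct if $|\mathrm{val}(x_i)-\mathrm{val}(x_j)|>1$ and arbitrary (possibly adversarial) otherwise. Sorting with error $k$ means outputting an ordering $x_{\pi(1)},\dots,x_{\pi(n)}$ with $\mathrm{val}(x_{\pi(i)})\ge\mathrm{val}(x_{\pi(j)})-k$ for all $i>j$, for every input and every consistent comparator behavior.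
   Formalization: The unknown values val(x_i) of the elements are taken to be rational numbers instead of real numbers. -}

module Defs where

open import Data.Nat using (ℕ; zero; suc; _+_; _*_; _∸_; _^_; _≤_; _<_; _⊓_)
open import Data.Nat.Combinatorics using (_C_)
open import Data.Fin using (Fin) renaming (_<_ to _<ᶠ_)
open import Data.Fin.Permutation using (Permutation′; _⟨$⟩ʳ_)
open import Data.Integer using (+_)
open import Data.Rational using (ℚ; 1ℚ) renaming (_+_ to _+ℚ_; _-_ to _-ℚ_; _<_ to _<ℚ_; _≤_ to _≤ℚ_; _/_ to _/ℚ_)
open import Data.Product using (_×_)
open import Data.Empty using (⊥)
open import Relation.Nullary using (¬_)

-- A deterministic comparison algorithm on n elements (indexed by Fin n),
-- as a decision tree: an internal node queries the comparator on (i , j)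
-- and continues in the first subtree if the answer is "x_i ≥ x_j", in the
-- second if the answer is "x_j ≥ x_i".  A leaf outputs an ordering
-- π (position p ↦ element π ⟨$⟩ʳ p), a permutation of Fin n.
data Alg (n : ℕ) : Set where
  leaf : Permutation′ n → Alg n
  query : Fin n → Fin n → Alg n → Alg n → Alg n

ℕ→ℚ : ℕ → ℚ
ℕ→ℚ k = (+ k) /ℚ 1

SortedWithError : ∀ {n} → (Fin n → ℚ) → ℕ → Permutation′ n → Set
SortedWithError val k π =
  ∀ (i j : Fin _) → j <ᶠ i → (val (π ⟨$⟩ʳ j) -ℚ ℕ→ℚ k) ≤ℚ val (π ⟨$⟩ʳ i)

-- SortsWithin val k b T : on every run of T against a comparator consistent
-- with val (answers correct when the values differ by more than 1, arbitrary
-- and possibly adaptive/adversarial otherwise), T makes at most b comparisons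
-- and outputs an ordering with error k.
SortsWithin : ∀ {n} → (Fin n → ℚ) → ℕ → ℕ → Alg n → Set
SortsWithin val k b (leaf π) = SortedWithError val k π
SortsWithin val k zero (query i j l r) = ⊥
SortsWithin val k (suc b) (query i j l r) =
  (¬ ((val i +ℚ 1ℚ) <ℚ val j) → SortsWithin val k b l) ×
  (¬ ((val j +ℚ 1ℚ) <ℚ val i) → SortsWithin val k b r)

c : ℕ → ℕ
c n = (n C 2) ⊓ (215 C 2)

-- C ≤ 7 · 2^(2k) · n^(1 + 2^(1-k)) + n · c_n, written exactly in ℕ:
-- with m = 2^(k-1) (k ≥ 1), this is  C - n·c_n ≤ (7·4^k·n) · n^(1/m),
-- i.e.  (C ∸ n·c_n)^m ≤ (7·4^k·n)^m · n.
WithinBound : ℕ → ℕ → ℕ → Set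
WithinBound n k C = (C ∸ n * c n) ^ m ≤ (7 * 4 ^ k * n) ^ m * n
  where m = 2 ^ (k ∸ 1)

{-# OPTIONS --safe #-}
module Submission where

-- Quicksort.  Comparing everything with a pivot x leaves an error of at most 2 between the
-- two sides, but the adversary can make the split useless.  So the pivot is chosen together
-- with disjoint sets A and B of m elements each, where A lies below x and B above x up to
-- error k - 1; sending A to the lower side, or B to the upper side, then costs error k only
-- and forces both sides to have at least m elements.
--
-- A round robin on 4d - 1 players has a player with d wins and d losses.  Starting from
-- pivots with A = B = {x}, such a player of a pool of pivots becomes a new pivot, whose A
-- (resp. B) unites the A's of d pivots below it (resp. the B's of d above it) and whose
-- error is one larger; these 2d pivots leave the pool.  After k - 1 levels a single pivot
-- with m = d₁ ⋯ d_{k-1} remains, and 2^k m - 1 elements were needed.  With N ≈ 2^t, the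
-- exponents of the d's are about t/2, t/4, … from the last level to the first, which makes
-- the cost of the levels O(N) and N/m about 2^(k-1) 2^⌈t/2^(k-1)⌉.
--
-- A division of N elements into parts of a ≤ b elements costs O(N), charged to the smaller
-- part: T N = N g(N) works if g(N) - g(a) is at least a constant times N/a for m ≤ a ≤ N/2.
-- Summing the increments of g over the powers of two gives the bound.

open import Defs
open import Data.Nat using (ℕ; _≤_; _^_)
open import Data.Fin using (Fin)
open import Data.Rational using (ℚ)
open import Data.Product using (Σ; _×_)
open import Data.Nat using (zero; suc; _+_; _*_; _∸_; _<_; z≤n; s≤s; s≤s⁻¹; _≤?_; _<?_; ⌊_/2⌋; ⌈_/2⌉; NonZero; _/_; _%_)
open import Data.Nat.Properties
open import Data.Nat.DivMod using (m≡m%n+[m/n]*n; m%n<n)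
open import Data.Nat.Solver using (module +-*-Solver)
open import Data.Fin using (cast; toℕ) renaming (zero to fzero; suc to fsuc)
import Data.Fin.Properties as Fin
open import Data.Fin.Permutation using (Permutation′; _⟨$⟩ʳ_; _∘ₚ_; cast-id)
import Data.Integer as ℤ
import Data.Integer.Properties as ℤ
import Data.Rational as ℚ
import Data.Rational.Properties as ℚ
import Data.Rational.Unnormalised as ℚᵘ
import Data.Rational.Unnormalised.Properties as ℚᵘ
open import Data.Empty using (⊥; ⊥-elim)
open import Data.Unit using (⊤; tt)
open import Data.Maybe using (Maybe; just; nothing)
open import Data.Product using (∃; _,_; proj₁; proj₂)
open import Data.Sum using (_⊎_; inj₁; inj₂)
open import Data.List as List using (List; []; _∷_; _++_; length; filter; concatMap; take; drop; lookup; allFin)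
open import Data.List.Properties using (length-++; length-take; length-map; length-tabulate; lookup-tabulate; ++-assoc; ++-identityʳ; concatMap-++; take++drop≡id)
open import Data.List.Membership.Propositional using (_∈_)
open import Data.List.Membership.Propositional.Properties using (∈-lookup)
open import Data.List.Relation.Unary.All as All using (All; []; _∷_)
import Data.List.Relation.Unary.All.Properties as All
open import Data.List.Relation.Unary.AllPairs using (AllPairs; []; _∷_)
import Data.List.Relation.Unary.AllPairs.Properties as AllPairs
open import Data.List.Relation.Unary.Any as Any using (Any; here; there)
open import Data.List.Relation.Binary.Sublist.Propositional using (_⊆_; []; _∷ʳ_; _∷_)
open import Data.List.Relation.Binary.Sublist.Propositional.Properties using (filter-⊆)
open import Data.List.Relation.Binary.Permutation.Homogeneous using (onIndices)
open import Data.List.Relation.Binary.Permutation.Propositional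
open import Data.List.Relation.Binary.Permutation.Propositional.Properties hiding (++-identityʳ; ++-assoc)
open import Data.List.Relation.Binary.Permutation.Setoid.Properties using (onIndices-lookup)
open import Relation.Binary.Definitions using (DecidableEquality)
open import Relation.Binary.PropositionalEquality using (_≡_; sym; cong; cong₂; subst; subst₂; setoid; module ≡-Reasoning) renaming (refl to ≡-refl; trans to ≡-trans)
open import Relation.Nullary using (¬_; Dec; yes; no; contradiction)
open import Relation.Nullary.Decidable using (_×-dec_)

-- Comparison programs with results of any type, and plain quicksort

data Prog (X A : Set) : Set where
  ret : A → Prog X A
  ask : X → X → Prog X A → Prog X A → Prog X A

module _ {X : Set} where

  infixl 4 _>>=_

  _>>=_ : {A B : Set} → Prog X A → (A → Prog X B) → Prog X B
  ret a >>= f = f a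
  ask i j l r >>= f = ask i j (l >>= f) (r >>= f)

  map : {A B : Set} → (A → B) → Prog X A → Prog X B
  map f (ret a) = ret (f a)
  map f (ask i j l r) = ask i j (map f l) (map f r)

  toLower : X → List X × List X → List X × List X
  toLower y (L , G) = y ∷ L , G

  toUpper : X → List X × List X → List X × List X
  toUpper y (L , G) = L , y ∷ G

  split : X → List X → Prog X (List X × List X)
  split x [] = ret ([] , [])
  split x (y ∷ ys) = ask x y (map (toLower y) (split x ys)) (map (toUpper y) (split x ys))

  join : X → Prog X (List X) → List X → Prog X (List X)
  join x p L = map (λ G → L ++ x ∷ G) p

  quicksort : ℕ → List X → Prog X (List X)
  quicksort zero xs = ret xs
  quicksort (suc f) [] = ret []
  quicksort (suc f) (x ∷ xs) = split x xs >>= λ (L , G) → quicksort f L >>= join x (quicksort f G)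

-- x ≼[ e ] y stands for val x ≤ val y + e.
record Scale (X : Set) : Set₁ where
  infix 4 _≼[_]_
  field
    _≼[_]_ : X → ℕ → X → Set
    ≼-refl : ∀ {x} → x ≼[ 0 ] x
    ≼-trans : ∀ {x y z d e} → x ≼[ d ] y → y ≼[ e ] z → x ≼[ d + e ] z
    ≼-mono : ∀ {x y d e} → d ≤ e → x ≼[ d ] y → x ≼[ e ] y

module Run {X : Set} (S : Scale X) where
  open Scale S

  -- Whether an answer is correct or adversarial, all that it guarantees is an inequality with error
  -- 1, so each branch has to succeed under exactly that hypothesis.
  Runs : {A : Set} → ℕ → (A → Set) → Prog X A → Set
  Runs b Q (ret a) = Q a
  Runs zero Q (ask i j l r) = ⊥
  Runs (suc b) Q (ask i j l r) = (j ≼[ 1 ] i → Runs b Q l) × (i ≼[ 1 ] j → Runs b Q r)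

  private variable
    A B : Set
    Q R : A → Set
    b d : ℕ

  runs-mono : (p : Prog X A) → b ≤ d → (∀ {a} → Q a → R a) → Runs b Q p → Runs d R p
  runs-mono (ret a) le f q = f q
  runs-mono (ask i j l r) (s≤s le) f (ql , qr) =
    (λ e → runs-mono l le f (ql e)) , (λ e → runs-mono r le f (qr e))

  runs-map : (p : Prog X A) {f : A → B} {R : B → Set} →
    (∀ {a} → Q a → R (f a)) → Runs b Q p → Runs b R (map f p)
  runs-map (ret a) h q = h q
  runs-map {b = suc b} (ask i j l r) h (ql , qr) =
    (λ e → runs-map l h (ql e)) , (λ e → runs-map r h (qr e))

  runs-bind : (p : Prog X A) {f : A → Prog X B} {R : B → Set} →
    (∀ {a} → Q a → Runs d R (f a)) → Runs b Q p → Runs (b + d) R (p >>= f)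
  runs-bind {d = d} {b = b} (ret a) {f} h q = runs-mono (f a) (m≤n+m d b) (λ z → z) (h q)
  runs-bind {b = suc b} (ask i j l r) h (ql , qr) =
    (λ e → runs-bind l h (ql e)) , (λ e → runs-bind r h (qr e))

  Split : X → List X → List X × List X → Set
  Split x ys (L , G) = L ++ G ↭ ys × All (_≼[ 1 ] x) L × All (x ≼[ 1 ]_) G

  split-runs : ∀ x ys → Runs (length ys) (Split x ys) (split x ys)
  split-runs x [] = refl , [] , []
  split-runs x (y ∷ ys) =
    (λ e → runs-map (split x ys) (λ (p , l , g) → prep y p , e ∷ l , g) (split-runs x ys)) ,
    (λ e → runs-map (split x ys) (λ {(L , G)} (p , l , g) →
      trans (shift y L G) (prep y p) , l , e ∷ g) (split-runs x ys))

  Sorted : ℕ → List X → List X → Set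
  Sorted k xs zs = zs ↭ xs × AllPairs (_≼[ k ]_) zs

  cross : ∀ {x d e k L G} → d + e ≤ k → All (_≼[ d ] x) L → All (x ≼[ e ]_) G →
    All (λ l → All (l ≼[ k ]_) G) L
  cross de ls gs = All.map (λ l → All.map (λ g → ≼-mono de (≼-trans l g)) gs) ls

  -- Each side is within error 1 of the pivot, so the error across the split is 2. The split may be
  -- useless, hence the quadratic cost: with `N` elements besides the pivot, `N + N * suc N` is one
  -- less than the square of `suc N`.
  quicksort-runs : ∀ {k} → 2 ≤ k → ∀ f xs → length xs ≤ f →
    Runs (length xs * length xs) (Sorted k xs) (quicksort f xs)
  quicksort-runs 2≤k zero [] le = refl , []
  quicksort-runs 2≤k (suc f) [] le = refl , []
  quicksort-runs {k} 2≤k (suc f) (x ∷ xs) (s≤s le) =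
    runs-mono (quicksort (suc f) (x ∷ xs)) (n≤1+n _) (λ z → z)
      (runs-bind (split x xs) (λ {a} → rest a) (split-runs x xs))
    where
    N = length xs
    rest : ∀ a → Split x xs a → Runs (N * suc N) (Sorted k (x ∷ xs)) (quicksort f (proj₁ a) >>= join x (quicksort f (proj₂ a)))
    rest (L , G) (p , l , g) =
      runs-mono (quicksort f L >>= join x (quicksort f G)) bound (λ z → z)
        (runs-bind (quicksort f L)
          (λ {L′} (pL , sL) → runs-map (quicksort f G) (λ {G′} (pG , sG) →
            trans (shift x L′ G′) (prep x (trans (++⁺ pL pG) p)) ,
            AllPairs.++⁺ sL
              (All.map (≼-mono 1≤k) (All-resp-↭ (↭-sym pG) g) ∷ sG)
              (All.zipWith (λ (u , v) → ≼-mono 1≤k u ∷ v)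
                (All-resp-↭ (↭-sym pL) l ,
                 All.map (All-resp-↭ (↭-sym pG)) (All-resp-↭ (↭-sym pL) (cross 2≤k l g)))))
            (quicksort-runs 2≤k f G (≤-trans nG le)))
          (quicksort-runs 2≤k f L (≤-trans nL le)))
      where
      1≤k = ≤-trans (s≤s z≤n) 2≤k
      nLG : length L + length G ≡ N
      nLG = ≡-trans (sym (length-++ L)) (↭-length p)
      nL : length L ≤ N
      nL = ≤-trans (m≤m+n _ _) (≤-reflexive nLG)
      nG : length G ≤ N
      nG = ≤-trans (m≤n+m _ _) (≤-reflexive nLG)
      bound : length L * length L + length G * length G ≤ N * suc N
      bound = begin
        length L * length L + length G * length G ≤⟨ +-mono-≤ (*-monoʳ-≤ (length L) nL) (*-monoʳ-≤ (length G) nG) ⟩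
        length L * N + length G * N ≡⟨ *-distribʳ-+ N (length L) (length G) ⟨
        (length L + length G) * N ≡⟨ cong (_* N) nLG ⟩
        N * N ≤⟨ *-monoʳ-≤ N (n≤1+n N) ⟩
        N * suc N ∎
        where open ≤-Reasoning

-- Round-robin tournaments and Landau's condition

record Score (I : Set) : Set where
  constructor score
  field
    item : I
    below above : List I
open Score

module Tournament {X I : Set} (key : I → X) where

  win lose : I → Score I → List I × List I × List (Score I) → List I × List I × List (Score I)
  win x (score y D U) (Dₓ , Uₓ , ss) = y ∷ Dₓ , Uₓ , score y D (x ∷ U) ∷ ss
  lose x (score y D U) (Dₓ , Uₓ , ss) = Dₓ , y ∷ Uₓ , score y (x ∷ D) U ∷ ss

  meet : I → List (Score I) → Prog X (List I × List I × List (Score I))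
  meet x [] = ret ([] , [] , [])
  meet x (s ∷ ss) =
    ask (key x) (key (item s)) (map (win x s) (meet x ss)) (map (lose x s) (meet x ss))

  enter : I → List I × List I × List (Score I) → List (Score I)
  enter x (D , U , ss) = score x D U ∷ ss

  roundRobin : List I → Prog X (List (Score I))
  roundRobin [] = ret []
  roundRobin (x ∷ xs) = roundRobin xs >>= λ ss → map (enter x) (meet x ss)

triangular : ℕ → ℕ
triangular zero = 0
triangular (suc n) = triangular n + n

2*triangular≤n*n : ∀ n → 2 * triangular n ≤ n * n
2*triangular≤n*n zero = z≤n
2*triangular≤n*n (suc n) = begin
  2 * (triangular n + n) ≡⟨ *-distribˡ-+ 2 (triangular n) n ⟩
  2 * triangular n + 2 * n ≤⟨ +-monoˡ-≤ (2 * n) (2*triangular≤n*n n) ⟩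
  n * n + 2 * n ≤⟨ n≤1+n _ ⟩
  suc (n * n + 2 * n) ≡⟨ solve 1 (λ n → con 1 :+ (n :* n :+ con 2 :* n) := (con 1 :+ n) :* (con 1 :+ n)) ≡-refl n ⟩
  suc n * suc n ∎
  where open ≤-Reasoning
        open +-*-Solver

module _ {I : Set} where

  total : (Score I → List I) → List (Score I) → ℕ
  total f [] = 0
  total f (s ∷ ss) = length (f s) + total f ss

  -- Landau's condition on score sequences, used for wins (f = below) and losses (f = above).
  Landau : (Score I → List I) → List (Score I) → Set
  Landau f ss = ∀ zs → zs ⊆ ss → length zs * length zs ≤ 2 * total f zs + length zs

  -- The condition on ss and ss′ that makes Landau f survive the entry of a player whose own
  -- f-list has length c, where ss′ is ss updated by the games of that player.
  Gain : (Score I → List I) → ℕ → List (Score I) → List (Score I) → Set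
  Gain f c ss ss′ = ∀ zs′ → zs′ ⊆ ss′ → ∃ λ zs → zs ⊆ ss × length zs ≡ length zs′ ×
    total f zs ≤ total f zs′ × length zs + total f zs ≤ c + total f zs′

  -- The newcomer's game with `s` is credited to `s`: if `s′` is in the sublist, the game is already
  -- in its total and pays for the extra element of `zs`.
  gain-old : ∀ f {c s s′ ss ss′} → length (f s′) ≡ suc (length (f s)) →
    Gain f c ss ss′ → Gain f c (s ∷ ss) (s′ ∷ ss′)
  gain-old f e G zs′ (_ ∷ʳ z) with G zs′ z
  ... | zs , z⊆ , l , t , u = zs , _ ∷ʳ z⊆ , l , t , u
  gain-old f {c} {s} {s′} e G (_ ∷ zs′) (≡-refl ∷ z) with G zs′ z
  ... | zs , z⊆ , l , t , u = s ∷ zs , ≡-refl ∷ z⊆ , cong suc l ,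
    +-mono-≤ (≤-trans (n≤1+n _) (≤-reflexive (sym e))) t ,
    (begin
      suc (length zs) + (a + total f zs) ≡⟨ solve 3 (λ l a t → con 1 :+ l :+ (a :+ t) := (con 1 :+ a) :+ (l :+ t)) ≡-refl (length zs) a (total f zs) ⟩
      suc a + (length zs + total f zs) ≤⟨ +-monoʳ-≤ (suc a) u ⟩
      suc a + (c + total f zs′) ≡⟨ cong (_+ (c + total f zs′)) e ⟨
      length (f s′) + (c + total f zs′) ≡⟨ solve 3 (λ a c t → a :+ (c :+ t) := c :+ (a :+ t)) ≡-refl (length (f s′)) c (total f zs′) ⟩
      c + (length (f s′) + total f zs′) ∎)
    where
    open ≤-Reasoning
    open +-*-Solver
    a = length (f s)

  -- Here the game is credited to the newcomer, and the increase of `c` pays instead; it is slack if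
  -- `s′` is left out.
  gain-new : ∀ f {c s s′ ss ss′} → length (f s′) ≡ length (f s) →
    Gain f c ss ss′ → Gain f (suc c) (s ∷ ss) (s′ ∷ ss′)
  gain-new f e G zs′ (_ ∷ʳ z) with G zs′ z
  ... | zs , z⊆ , l , t , u = zs , _ ∷ʳ z⊆ , l , t , m≤n⇒m≤1+n u
  gain-new f {c} {s} {s′} e G (_ ∷ zs′) (≡-refl ∷ z) with G zs′ z
  ... | zs , z⊆ , l , t , u = s ∷ zs , ≡-refl ∷ z⊆ , cong suc l ,
    +-mono-≤ (≤-reflexive (sym e)) t ,
    (begin
      suc (length zs) + (a + total f zs) ≡⟨ solve 3 (λ l a t → con 1 :+ l :+ (a :+ t) := (con 1 :+ a) :+ (l :+ t)) ≡-refl (length zs) a (total f zs) ⟩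
      suc a + (length zs + total f zs) ≤⟨ +-monoʳ-≤ (suc a) u ⟩
      suc a + (c + total f zs′) ≡⟨ cong (λ n → suc n + (c + total f zs′)) e ⟨
      suc (length (f s′)) + (c + total f zs′) ≡⟨ solve 3 (λ a c t → con 1 :+ a :+ (c :+ t) := con 1 :+ c :+ (a :+ t)) ≡-refl (length (f s′)) c (total f zs′) ⟩
      suc c + (length (f s′) + total f zs′) ∎)
    where
    open ≤-Reasoning
    open +-*-Solver
    a = length (f s)

  -- Without the newcomer a sublist keeps its inequality because totals only grow. With the newcomer
  -- and `n` others it contains `n` more games, each credited to one of its members; twice these and
  -- the linear term's increase by 1 make up the difference of the squares, `2 * n + 1`.
  landau-enter : ∀ f {s ss ss′} → Landau f ss → Gain f (length (f s)) ss ss′ → Landau f (s ∷ ss′)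
  landau-enter f L G zs′ (_ ∷ʳ z) with G zs′ z
  ... | zs , z⊆ , l , t , u rewrite sym l =
    ≤-trans (L zs z⊆) (+-monoˡ-≤ (length zs) (*-monoʳ-≤ 2 t))
  landau-enter f {s} L G (_ ∷ zs′) (≡-refl ∷ z) with G zs′ z
  ... | zs , z⊆ , l , t , u rewrite sym l = begin
      suc n * suc n ≡⟨ solve 1 (λ n → (con 1 :+ n) :* (con 1 :+ n) := n :* n :+ (con 1 :+ con 2 :* n)) ≡-refl n ⟩
      n * n + (1 + 2 * n) ≤⟨ +-monoˡ-≤ (1 + 2 * n) (L zs z⊆) ⟩
      2 * total f zs + n + (1 + 2 * n) ≡⟨ solve 2 (λ n t → con 2 :* t :+ n :+ (con 1 :+ con 2 :* n) := con 2 :* (n :+ t) :+ (con 1 :+ n)) ≡-refl n (total f zs) ⟩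
      2 * (n + total f zs) + suc n ≤⟨ +-monoˡ-≤ (suc n) (*-monoʳ-≤ 2 u) ⟩
      2 * (length (f s) + total f zs′) + suc n ∎
    where
    open ≤-Reasoning
    open +-*-Solver
    n = length zs

  -- The total is at most `n * (d ∸ 1)`, so Landau's inequality divided by `n` gives the bound. The
  -- division is why the empty list is a separate case.
  few : ∀ f {d zs} → 1 ≤ d → All (λ s → length (f s) < d) zs →
    length zs * length zs ≤ 2 * total f zs + length zs → suc (length zs) ≤ 2 * d
  few f {zs = []} 1≤d _ _ = ≤-trans 1≤d (m≤m+n _ _)
  few f {d} {zs@(_ ∷ _)} 1≤d small land = *-cancelˡ-≤ n (begin
      n * suc n ≡⟨ solve 1 (λ n → n :* (con 1 :+ n) := n :* n :+ n) ≡-refl n ⟩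
      n * n + n ≤⟨ +-monoˡ-≤ n land ⟩
      2 * total f zs + n + n ≡⟨ solve 2 (λ n t → con 2 :* t :+ n :+ n := con 2 :* (n :+ t)) ≡-refl n (total f zs) ⟩
      2 * (n + total f zs) ≤⟨ *-monoʳ-≤ 2 (bound small) ⟩
      2 * (n * d) ≡⟨ solve 2 (λ n d → con 2 :* (n :* d) := n :* (con 2 :* d)) ≡-refl n d ⟩
      n * (2 * d) ∎)
    where
    open ≤-Reasoning
    open +-*-Solver
    n = length zs
    bound : ∀ {zs} → All (λ s → length (f s) < d) zs → length zs + total f zs ≤ length zs * d
    bound [] = z≤n
    bound {s ∷ zs} (p ∷ ps) = begin
      suc (length zs) + (length (f s) + total f zs) ≡⟨ solve 3 (λ l a t → con 1 :+ l :+ (a :+ t) := (con 1 :+ a) :+ (l :+ t)) ≡-refl (length zs) (length (f s)) (total f zs) ⟩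
      suc (length (f s)) + (length zs + total f zs) ≤⟨ +-mono-≤ p (bound ps) ⟩
      d + length zs * d ∎

  Balanced : ℕ → Score I → Set
  Balanced d s = d ≤ length (below s) × d ≤ length (above s)

  balanced? : ∀ d s → Dec (Balanced d s)
  balanced? d s = (d ≤? length (below s)) ×-dec (d ≤? length (above s))

  cover : ∀ {A : Set} {P Q : A → Set} (P? : ∀ a → Dec (P a)) (Q? : ∀ a → Dec (Q a)) {xs} →
    All (λ a → P a ⊎ Q a) xs → length xs ≤ length (filter P? xs) + length (filter Q? xs)
  cover P? Q? [] = z≤n
  cover P? Q? {x ∷ xs} (o ∷ os) with P? x | Q? x | o
  ... | yes _ | yes _ | _ = s≤s (≤-trans (cover P? Q? os) (+-monoʳ-≤ _ (n≤1+n _)))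
  ... | yes _ | no _ | _ = s≤s (cover P? Q? os)
  ... | no _ | yes _ | _ = ≤-trans (s≤s (cover P? Q? os)) (≤-reflexive (sym (+-suc _ _)))
  ... | no ¬p | no ¬q | inj₁ p = ⊥-elim (¬p p)
  ... | no ¬p | no ¬q | inj₂ q = ⊥-elim (¬q q)

  -- By `few`, at most `2 * d ∸ 1` players lack wins and at most `2 * d ∸ 1` lack losses, which is
  -- one short of `4 * d ∸ 1`. The double negation suffices because `choose` decides the search.
  exists-balanced : ∀ {d ss} → 1 ≤ d → 4 * d ≤ suc (length ss) →
    Landau below ss → Landau above ss → ¬ ¬ Any (Balanced d) ss
  exists-balanced {d} {ss} 1≤d size Lb La none = <⇒≱ (begin-strict
      suc (length ss) <⟨ s≤s (s≤s (cover B? A? (All.map (λ {s} → either s) (All.¬Any⇒All¬ ss none)))) ⟩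
      suc (suc (length (filter B? ss) + length (filter A? ss))) ≡⟨ cong suc (+-suc _ _) ⟨
      suc (length (filter B? ss)) + suc (length (filter A? ss))
        ≤⟨ +-mono-≤ (few below 1≤d (All.all-filter B? ss) (Lb _ (filter-⊆ B? ss)))
                    (few above 1≤d (All.all-filter A? ss) (La _ (filter-⊆ A? ss))) ⟩
      2 * d + 2 * d ≡⟨ *-distribʳ-+ d 2 2 ⟨
      4 * d ∎) size
    where
    open ≤-Reasoning
    B? : ∀ s → Dec (length (below s) < d)
    B? s = length (below s) <? d
    A? : ∀ s → Dec (length (above s) < d)
    A? s = length (above s) <? d
    either : ∀ s → ¬ Balanced d s → length (below s) < d ⊎ length (above s) < d
    either s ¬b with d ≤? length (below s) | d ≤? length (above s)
    ... | no p | _ = inj₁ (≰⇒> p)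
    ... | yes _ | no q = inj₂ (≰⇒> q)
    ... | yes p | yes q = ⊥-elim (¬b (p , q))

  choose : ℕ → List (Score I) → Maybe (Score I)
  choose d ss with Any.any? (balanced? d) ss
  ... | yes a = just (Any.lookup a)
  ... | no _ = nothing

module TournamentRun {X I : Set} (S : Scale X) (key : I → X) where
  open Scale S
  open Run S
  open Tournament key

  -- The permutation puts every opponent in just one of `D` and `U`; the disjointness of the sets
  -- that `fuse` unites comes from here.
  Placed : List I → Score I → Set
  Placed P (score x D U) = x ∷ D ++ U ↭ P ×
    All (λ y → key y ≼[ 1 ] key x) D × All (λ y → key x ≼[ 1 ] key y) U

  record Met (x : I) (ss : List (Score I)) (r : List I × List I × List (Score I)) : Set where
    constructor met
    field
      perm : proj₁ r ++ proj₁ (proj₂ r) ↭ List.map item ss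
      low : All (λ y → key y ≼[ 1 ] key x) (proj₁ r)
      high : All (λ y → key x ≼[ 1 ] key y) (proj₁ (proj₂ r))
      items : List.map item (proj₂ (proj₂ r)) ≡ List.map item ss
      placed : ∀ {P} → All (Placed P) ss → All (Placed (x ∷ P)) (proj₂ (proj₂ r))
      gainBelow : Gain below (length (proj₁ r)) ss (proj₂ (proj₂ r))
      gainAbove : Gain above (length (proj₁ (proj₂ r))) ss (proj₂ (proj₂ r))

  meet-runs : ∀ x ss → Runs (length ss) (Met x ss) (meet x ss)
  meet-runs x [] = met refl [] [] ≡-refl (λ _ → []) nil nil
    where
    nil : ∀ {f} → Gain f 0 [] []
    nil _ [] = [] , [] , ≡-refl , z≤n , z≤n
  meet-runs x (s@(score y D U) ∷ ss) =
    (λ e → runs-map (meet x ss) (λ (met p l h i pl gb ga) → met (prep y p) (e ∷ l) h (cong (y ∷_) i)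
      (λ { ((q , ql , qh) ∷ qs) → (trans (trans (prep y (shift x D U)) (swap y x refl)) (prep x q) , ql , e ∷ qh) ∷ pl qs })
      (gain-new below ≡-refl gb) (gain-old above ≡-refl ga)) (meet-runs x ss)) ,
    (λ e → runs-map (meet x ss) (λ {(Dₓ , Uₓ , _)} (met p l h i pl gb ga) →
      met (trans (shift y Dₓ Uₓ) (prep y p)) l (e ∷ h) (cong (y ∷_) i)
      (λ { ((q , ql , qh) ∷ qs) → (trans (swap y x refl) (prep x q) , e ∷ ql , qh) ∷ pl qs })
      (gain-old below ≡-refl gb) (gain-new above ≡-refl ga)) (meet-runs x ss))

  record Complete (P : List I) (ss : List (Score I)) : Set where
    constructor complete
    field
      items : List.map item ss ≡ P
      placed : All (Placed P) ss
      landauBelow : Landau below ss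
      landauAbove : Landau above ss

  roundRobin-runs : ∀ P → Runs (triangular (length P)) (Complete P) (roundRobin P)
  roundRobin-runs [] = complete ≡-refl [] nil nil
    where
    nil : ∀ {f} → Landau f []
    nil _ [] = z≤n
  roundRobin-runs (x ∷ P) = runs-bind (roundRobin P) step (roundRobin-runs P)
    where
    step : ∀ {ss} → Complete P ss → Runs (length P) (Complete (x ∷ P)) (map (enter x) (meet x ss))
    step {ss} (complete ≡-refl pl lb la) =
      subst (λ b → Runs b (Complete (x ∷ P)) (map (enter x) (meet x ss))) (sym (length-map item ss))
        (runs-map (meet x ss) (λ (met p l h i pl′ gb ga) →
        complete (cong (x ∷_) i) ((prep x p , l , h) ∷ pl′ pl) (landau-enter below lb gb) (landau-enter above la ga))
        (meet-runs x ss))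

  Chosen : ℕ → List I → Maybe (Score I) → Set
  Chosen d P r = ∃ λ s → r ≡ just s × Placed P s × Balanced d s

  choose-runs : ∀ {d} P → 1 ≤ d → 4 * d ≤ suc (length P) →
    Runs (triangular (length P)) (Chosen d P) (map (choose d) (roundRobin P))
  choose-runs {d} P 1≤d size = runs-map (roundRobin P) (λ {ss} → step ss) (roundRobin-runs P)
    where
    step : ∀ ss → Complete P ss → Chosen d P (choose d ss)
    step ss (complete ≡-refl pl lb la) with Any.any? (balanced? d) ss
    ... | yes a = _ , ≡-refl , All.lookupAny pl a
    ... | no none = ⊥-elim (exists-balanced 1≤d (subst (λ n → 4 * d ≤ suc n) (length-map item ss) size) lb la none)

open Score

-- Inclusion of lists as multisets

module _ {A : Set} where

  infix 4 _⊑_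
  -- Multiplicities count, so `lo p ++ hi p ⊑ ground p` also expresses that the two sets occupy
  -- disjoint places of the ground.
  _⊑_ : List A → List A → Set
  as ⊑ bs = ∃ λ cs → as ++ cs ↭ bs

  ⊑-refl : ∀ {as} → as ⊑ as
  ⊑-refl {as} = [] , ↭-reflexive (++-identityʳ as)

  ⊑-trans : ∀ {as bs cs} → as ⊑ bs → bs ⊑ cs → as ⊑ cs
  ⊑-trans {as} (r , p) (s , q) =
    r ++ s , trans (↭-reflexive (sym (++-assoc as r s))) (trans (++⁺ʳ s p) q)

  ⊑-respʳ : ∀ {as bs cs} → bs ↭ cs → as ⊑ bs → as ⊑ cs
  ⊑-respʳ q (r , p) = r , trans p q

  ⊑-++ : ∀ {as bs cs ds} → as ⊑ bs → cs ⊑ ds → as ++ cs ⊑ bs ++ ds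
  ⊑-++ {as} {cs = cs} (r , p) (s , q) = r ++ s , trans (interchange as cs r s) (++⁺ p q)
    where
    interchange : ∀ (a b c d : List A) → (a ++ b) ++ (c ++ d) ↭ (a ++ c) ++ (b ++ d)
    interchange a b c d =
      trans (↭-reflexive (++-assoc a b (c ++ d)))
        (trans (++⁺ˡ a (shifts b c)) (↭-reflexive (sym (++-assoc a c (b ++ d)))))

  ⊑-++ˡ : ∀ {as bs} → as ⊑ as ++ bs
  ⊑-++ˡ {bs = bs} = bs , refl

module _ {A B : Set} where

  concatMap-↭ : ∀ (f : A → List B) {xs ys} → xs ↭ ys → concatMap f xs ↭ concatMap f ys
  concatMap-↭ f refl = refl
  concatMap-↭ f (prep x p) = ++⁺ˡ (f x) (concatMap-↭ f p)
  concatMap-↭ f (swap x y p) = trans (shifts (f x) (f y)) (++⁺ˡ (f y) (++⁺ˡ (f x) (concatMap-↭ f p)))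
  concatMap-↭ f (trans p q) = trans (concatMap-↭ f p) (concatMap-↭ f q)

  concatMap-⊑ : ∀ (f g : A → List B) {xs} → All (λ x → f x ⊑ g x) xs → concatMap f xs ⊑ concatMap g xs
  concatMap-⊑ f g [] = ⊑-refl
  concatMap-⊑ f g (p ∷ ps) = ⊑-++ p (concatMap-⊑ f g ps)

  length-concatMap : ∀ (f : A → List B) {w xs} → All (λ x → length (f x) ≡ w) xs →
    length (concatMap f xs) ≡ length xs * w
  length-concatMap f [] = ≡-refl
  length-concatMap f {xs = x ∷ _} (e ∷ es) =
    ≡-trans (length-++ (f x)) (cong₂ _+_ e (length-concatMap f es))

  All-concatMap : ∀ (f : A → List B) {P : B → Set} {xs} → All (λ x → All P (f x)) xs → All P (concatMap f xs)
  All-concatMap f [] = []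
  All-concatMap f (p ∷ ps) = All.++⁺ p (All-concatMap f ps)

-- Pivots with candidate sets, and the levels that build them

length-take-≤ : ∀ {A : Set} {n} {xs : List A} → n ≤ length xs → length (take n xs) ≡ n
length-take-≤ {n = n} {xs} le = ≡-trans (length-take n xs) (m≤n⇒m⊓n≡m le)

-- Getting `q` pivots at a level takes `2 * d * suc q ∸ 1` of them: each extraction removes `2 * d`,
-- and the last still needs `4 * d ∸ 1`. So `size ds ∸ 1` is the number from which the levels `ds`
-- leave a single pivot, whence the 2 for `[]`.
size weight : List ℕ → ℕ
size [] = 2
size (d ∷ ds) = 2 * d * size ds
weight [] = 1
weight (d ∷ ds) = d * weight ds

cost : List ℕ → ℕ
cost [] = 0
cost (d ∷ ds) = (size ds ∸ 1) * (8 * (d * d)) + cost ds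

1≤size : ∀ {ds} → All (1 ≤_) ds → 1 ≤ size ds
1≤size [] = s≤s z≤n
1≤size (p ∷ ps) = *-mono-≤ (*-mono-≤ {1} {2} (s≤s z≤n) p) (1≤size ps)

record Pivot (X : Set) : Set where
  constructor pivot
  field
    key : X
    lo hi ground : List X
open Pivot

module _ {X : Set} where
  open Tournament {X} {Pivot X} key

  fuse : ℕ → Score (Pivot X) → Pivot X
  fuse d (score x D U) = pivot (key x) (concatMap lo (take d D)) (concatMap hi (take d U))
    (concatMap ground (take d D) ++ concatMap ground (take d U))

  unused : ℕ → Score (Pivot X) → List (Pivot X)
  unused d (score x D U) = x ∷ drop d D ++ drop d U

  record-pivot : ℕ → (List (Pivot X) → Prog X (List (Pivot X))) → List (Pivot X) →
    Maybe (Score (Pivot X)) → Prog X (List (Pivot X))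
  record-pivot d rec P nothing = ret []
  record-pivot d rec P (just s) = map (fuse d s ∷_) (rec (unused d s ++ P))

  extract : ℕ → ℕ → List (Pivot X) → Prog X (List (Pivot X))
  extract d zero P = ret []
  extract d (suc q) P = map (choose d) (roundRobin (take (4 * d ∸ 1) P)) >>=
    record-pivot d (extract d q) (drop (4 * d ∸ 1) P)

  levels : List ℕ → List (Pivot X) → Prog X (List (Pivot X))
  levels [] P = ret P
  levels (d ∷ ds) P = extract d (size ds ∸ 1) P >>= levels ds

  unit : X → Pivot X
  unit x = pivot x (x ∷ []) (x ∷ []) (x ∷ [])

module PivotRun {X : Set} (S : Scale X) where
  open Scale S
  open Run S
  open Tournament {X} {Pivot X} key
  open TournamentRun S (key {X})

  record Central (j w : ℕ) (p : Pivot X) : Set where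
    constructor central
    field
      lengthLo : length (lo p) ≡ w
      lengthHi : length (hi p) ≡ w
      lo≼ : All (_≼[ j ] key p) (lo p)
      ≼hi : All (key p ≼[ j ]_) (hi p)
  open Central

  -- In `unit x` both sets are the same element, so it is only `Weak`. The final division needs
  -- disjoint sets, that is `Strong`.
  Weak Strong : ℕ → ℕ → Pivot X → Set
  Weak j w p = Central j w p × lo p ⊑ ground p × hi p ⊑ ground p
  Strong j w p = Central j w p × lo p ++ hi p ⊑ ground p

  strong⇒weak : ∀ {j w p} → Strong j w p → Weak j w p
  strong⇒weak {p = p} (c , s) = c , ⊑-trans ⊑-++ˡ s ,
    ⊑-trans (⊑-respʳ (++-comm (hi p) (lo p)) ⊑-++ˡ) s

  -- The comparison of `x` with the other key adds 1 to the error. Lower sets are taken from pivots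
  -- in `D` and upper sets from pivots in `U`, so an overlap of the two sets inside one old pivot
  -- does no harm.
  fuse-strong : ∀ {j w d P s} → All (Weak j w) P → Placed P s → Balanced d s → Strong (suc j) (d * w) (fuse d s)
  fuse-strong {j} {w} {d} {P} {score x D U} ok (perm , low , high) (bD , bU) =
    central
      (≡-trans (length-concatMap lo (All.map (λ z → lengthLo (proj₁ z)) okD)) (cong (_* w) (length-take-≤ bD)))
      (≡-trans (length-concatMap hi (All.map (λ z → lengthHi (proj₁ z)) okU)) (cong (_* w) (length-take-≤ bU)))
      (All-concatMap lo (All.zipWith (λ ((c , _) , e) →
        All.map (λ a → ≼-mono (≤-reflexive (+-comm j 1)) (≼-trans a e)) (lo≼ c)) (okD , All.take⁺ d low)))
      (All-concatMap hi (All.zipWith (λ ((c , _) , e) →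
        All.map (λ a → ≼-trans e a) (≼hi c)) (okU , All.take⁺ d high))) ,
    ⊑-++ (concatMap-⊑ lo ground (All.map (λ z → proj₁ (proj₂ z)) okD))
         (concatMap-⊑ hi ground (All.map (λ z → proj₂ (proj₂ z)) okU))
    where
    okP = All-resp-↭ (↭-sym perm) ok
    okD = All.take⁺ d (All.++⁻ˡ D (All.tail okP))
    okU = All.take⁺ d (All.++⁻ʳ D (All.tail okP))

  consume-↭ : ∀ {d n P s} → Placed (take n P) s →
    (take d (below s) ++ take d (above s)) ++ (unused d s ++ drop n P) ↭ P
  consume-↭ {d} {n} {P} {score x D U} (perm , _) = begin
    (tD ++ tU) ++ x ∷ (dD ++ dU) ++ R ≡⟨ ++-assoc tD tU _ ⟩
    tD ++ tU ++ x ∷ (dD ++ dU) ++ R ≡⟨ cong (λ z → tD ++ tU ++ x ∷ z) (++-assoc dD dU R) ⟩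
    tD ++ tU ++ x ∷ dD ++ dU ++ R ↭⟨ ++⁺ˡ tD (shift x tU _) ⟩
    tD ++ x ∷ tU ++ dD ++ dU ++ R ↭⟨ shift x tD _ ⟩
    x ∷ tD ++ tU ++ dD ++ dU ++ R ↭⟨ prep x (++⁺ˡ tD (shifts tU dD)) ⟩
    x ∷ tD ++ dD ++ tU ++ dU ++ R ≡⟨ cong (x ∷_) (++-assoc tD dD _) ⟨
    x ∷ (tD ++ dD) ++ tU ++ dU ++ R ≡⟨ cong (λ z → x ∷ (tD ++ dD) ++ z) (++-assoc tU dU R) ⟨
    x ∷ (tD ++ dD) ++ (tU ++ dU) ++ R ≡⟨ cong₂ (λ a b → x ∷ a ++ b ++ R) (take++drop≡id d D) (take++drop≡id d U) ⟩
    x ∷ D ++ U ++ R ≡⟨ cong (x ∷_) (++-assoc D U R) ⟨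
    x ∷ (D ++ U) ++ R ↭⟨ ++⁺ʳ R perm ⟩
    take n P ++ R ≡⟨ take++drop≡id n P ⟩
    P ∎
    where
    open PermutationReasoning
    tD = take d D
    tU = take d U
    dD = drop d D
    dU = drop d U
    R = drop n P

  Extracted : ℕ → ℕ → ℕ → List (Pivot X) → List (Pivot X) → Set
  Extracted j w q P out =
    length out ≡ q × All (Strong j w) out × concatMap ground out ⊑ concatMap ground P

  extract-runs : ∀ {j w d} → 1 ≤ d → ∀ q P → All (Weak j w) P → 2 * d * suc q ≤ suc (length P) →
    Runs (q * (8 * (d * d))) (Extracted (suc j) (d * w) q P) (extract d q P)
  extract-runs 1≤d zero P ok size = ≡-refl , [] , _ , refl
  extract-runs {j} {w} {d} 1≤d (suc q) P ok size =
    runs-mono (extract d (suc q) P) (+-monoˡ-≤ _ round) (λ z → z)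
      (runs-bind (map (choose d) (roundRobin Q)) step
        (choose-runs Q 1≤d (≤-reflexive (sym (≡-trans (cong suc lenQ) n+1)))))
    where
    n = 4 * d ∸ 1
    Q = take n P
    n+1 : suc n ≡ 4 * d
    n+1 = m+[n∸m]≡n {1} (≤-trans 1≤d (m≤m+n d _))
    n≤P : n ≤ length P
    n≤P = s≤s⁻¹ (begin
      suc n ≡⟨ n+1 ⟩
      4 * d ≡⟨ solve 1 (λ d → con 4 :* d := con 2 :* d :* con 2) ≡-refl d ⟩
      2 * d * 2 ≤⟨ *-monoʳ-≤ (2 * d) (s≤s (s≤s z≤n)) ⟩
      2 * d * suc (suc q) ≤⟨ size ⟩
      suc (length P) ∎)
      where open ≤-Reasoning
            open +-*-Solver
    lenQ : length Q ≡ n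
    lenQ = length-take-≤ n≤P
    round : triangular (length Q) ≤ 8 * (d * d)
    round = *-cancelˡ-≤ 2 (begin
      2 * triangular (length Q) ≤⟨ 2*triangular≤n*n (length Q) ⟩
      length Q * length Q ≡⟨ cong₂ _*_ lenQ lenQ ⟩
      n * n ≤⟨ *-mono-≤ (n≤1+n n) (n≤1+n n) ⟩
      suc n * suc n ≡⟨ cong₂ _*_ n+1 n+1 ⟩
      4 * d * (4 * d) ≡⟨ solve 1 (λ d → con 4 :* d :* (con 4 :* d) := con 2 :* (con 8 :* (d :* d))) ≡-refl d ⟩
      2 * (8 * (d * d)) ∎)
      where open ≤-Reasoning
            open +-*-Solver
    step : ∀ {r} → Chosen d Q r →
      Runs (q * (8 * (d * d))) (Extracted (suc j) (d * w) (suc q) P) (record-pivot d (extract d q) (drop n P) r)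
    step (s , ≡-refl , placed , bal@(bD , bU)) =
      runs-map (extract d q P′) (λ {out} (l , st , g) →
        cong suc l , fuse-strong (All.take⁺ n ok) placed bal ∷ st ,
        -- The grounds of the consumed pivots and of the remaining pool make up the ground of `P`,
        -- so the new pivots have disjoint grounds.
        ⊑-respʳ (trans (↭-reflexive (sym ground-++)) (concatMap-↭ ground perm)) (⊑-++ ⊑-refl g))
      (extract-runs 1≤d q P′ (All.++⁻ʳ used (All-resp-↭ (↭-sym perm) ok)) size′)
      where
      P′ = unused d s ++ drop n P
      used = take d (below s) ++ take d (above s)
      perm : used ++ P′ ↭ P
      perm = consume-↭ {d} {n} placed
      ground-++ : concatMap ground (used ++ P′) ≡ (concatMap ground (take d (below s)) ++ concatMap ground (take d (above s))) ++ concatMap ground P′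
      ground-++ = ≡-trans (concatMap-++ ground used P′) (cong (_++ concatMap ground P′) (concatMap-++ ground (take d (below s)) _))
      length-P : length P ≡ 2 * d + length P′
      length-P = begin
        length P ≡⟨ ↭-length perm ⟨
        length (used ++ P′) ≡⟨ length-++ used ⟩
        length used + length P′ ≡⟨ cong (_+ length P′) (length-++ (take d (below s))) ⟩
        length (take d (below s)) + length (take d (above s)) + length P′ ≡⟨ cong₂ (λ a b → a + b + length P′) (length-take-≤ bD) (length-take-≤ bU) ⟩
        d + d + length P′ ≡⟨ cong (λ z → d + z + length P′) (+-identityʳ d) ⟨
        2 * d + length P′ ∎
        where open ≡-Reasoning
      size′ : 2 * d * suc q ≤ suc (length P′)
      size′ = +-cancelˡ-≤ (2 * d) _ _ (begin
        2 * d + 2 * d * suc q ≡⟨ *-suc (2 * d) (suc q) ⟨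
        2 * d * suc (suc q) ≤⟨ size ⟩
        suc (length P) ≡⟨ cong suc length-P ⟩
        suc (2 * d + length P′) ≡⟨ +-suc (2 * d) _ ⟨
        2 * d + suc (length P′) ∎)
        where open ≤-Reasoning

  Found : ℕ → ℕ → List (Pivot X) → List (Pivot X) → Set
  Found j w P out = ∃ λ p → out ≡ p ∷ [] × Central j w p × lo p ++ hi p ⊑ concatMap ground P

  suc-pred-size : ∀ {ds} → All (1 ≤_) ds → suc (size ds ∸ 1) ≡ size ds
  suc-pred-size ps = m+[n∸m]≡n {1} (1≤size ps)

  levels-runs : ∀ {j w ds} P → All (1 ≤_) ds → All (Strong j w) P → suc (length P) ≡ size ds →
    Runs (cost ds) (Found (length ds + j) (weight ds * w) P) (levels ds P)

  -- The process starts from units, which are only `Weak`; one level makes its pivots `Strong`, and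
  -- the induction continues with `levels-runs`.
  levels-runs⁺ : ∀ {j w d ds} P → All (1 ≤_) (d ∷ ds) → All (Weak j w) P → suc (length P) ≡ size (d ∷ ds) →
    Runs (cost (d ∷ ds)) (Found (suc (length ds) + j) (weight (d ∷ ds) * w) P) (levels (d ∷ ds) P)

  levels-runs {w = w} {[]} (p ∷ []) _ ((c , s) ∷ []) _ =
    p , ≡-refl , subst (λ w → Central _ w p) (sym (*-identityˡ w)) c ,
    ⊑-respʳ (↭-reflexive (sym (++-identityʳ (ground p)))) s
  levels-runs {ds = d ∷ ds} P ps ok e = levels-runs⁺ P ps (All.map strong⇒weak ok) e

  levels-runs⁺ {j} {w} {d} {ds} P (p ∷ ps) ok e =
    runs-bind (extract d (size ds ∸ 1) P) (λ {P′} (l , st , g) →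
      runs-mono (levels ds P′) ≤-refl
        (λ {out} (q , e′ , c , s) → q , e′ ,
          subst₂ (λ j w → Central j w q) (+-suc (length ds) j)
            (solve 3 (λ a d w → a :* (d :* w) := d :* a :* w) ≡-refl (weight ds) d w) c ,
          ⊑-trans s g)
        (levels-runs P′ ps st (≡-trans (cong suc l) (suc-pred-size ps))))
      (extract-runs p (size ds ∸ 1) P ok
        (≤-reflexive (≡-trans (cong (2 * d *_) (suc-pred-size ps)) (sym e))))
    where
    open +-*-Solver

open Pivot

-- Division around the final pivot, and the recursive sort

module Sort {X : Set} (_≟_ : DecidableEquality X) where

  remove : X → List X → List X
  remove y [] = []
  remove y (x ∷ xs) with y ≟ x
  ... | yes _ = xs
  ... | no _ = x ∷ remove y xs

  infixl 5 _∖_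
  _∖_ : List X → List X → List X
  xs ∖ [] = xs
  xs ∖ (y ∷ ys) = remove y xs ∖ ys

  remove-↭ : ∀ {y xs} → y ∈ xs → y ∷ remove y xs ↭ xs
  remove-↭ {y} {x ∷ xs} y∈ with y ≟ x | y∈
  ... | yes ≡-refl | _ = refl
  ... | no y≢x | here y≡x = contradiction y≡x y≢x
  ... | no _ | there y∈′ = trans (swap y x refl) (prep x (remove-↭ y∈′))

  ∖-↭ : ∀ {ys xs} → ys ⊑ xs → ys ++ (xs ∖ ys) ↭ xs
  ∖-↭ {[]} _ = refl
  ∖-↭ {y ∷ ys} {xs} (r , p) = trans (prep y (∖-↭ (r , drop-∷ (trans p (↭-sym q))))) q
    where
    q : y ∷ remove y xs ↭ xs
    q = remove-↭ (∈-resp-↭ p (here ≡-refl))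

  finish : Pivot X → List X × List X → Prog X (List X × List X)
  finish p (L , G) with length G ≤? length L
  ... | yes _ = map (λ (L′ , G′) → L ++ L′ , hi p ++ G ++ G′) (split (key p) (lo p))
  ... | no _ = map (λ (L′ , G′) → lo p ++ L ++ L′ , G ++ G′) (split (key p) (hi p))

  -- The key may be among the elements compared with it; a query of an element against itself is
  -- legitimate, and both answers are consistent.
  divide : List X → List (Pivot X) → Prog X (List X × List X)
  divide xs [] = ret ([] , xs)
  divide xs (p ∷ _) = split (key p) (xs ∖ (lo p ++ hi p)) >>= finish p

  partition : List ℕ → List X → Prog X (List X × List X)
  partition ds xs = levels ds (List.map unit (take (size ds ∸ 1) xs)) >>= divide xs

  append : Prog X (List X) → List X → Prog X (List X)
  append p L = map (L ++_) p

  conquer : (List X → Prog X (List X)) → List X × List X → Prog X (List X)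
  conquer rec (L , G) = rec L >>= append (rec G)

  sort : ℕ → (ℕ → List ℕ) → ℕ → List X → Prog X (List X)
  sort B D zero xs = ret xs
  sort B D (suc f) xs with length xs <? B
  ... | yes _ = quicksort (length xs) xs
  ... | no _ = partition (D (length xs)) xs >>= conquer (sort B D f)

  length-parts : ∀ {m} (as bs L : List X) {G rest} → length as ≡ m → length bs ≡ m → L ++ G ↭ rest →
    length (as ++ bs ++ rest) ≡ m + (m + (length L + length G))
  length-parts as bs L a b perm = ≡-trans (length-++ as) (cong₂ _+_ a
    (≡-trans (length-++ bs) (cong₂ _+_ b (≡-trans (sym (↭-length perm)) (length-++ L)))))

  -- Setting aside `2 * m` candidates leaves at least `2 * m` elements, and the larger side has at
  -- least half of them.
  half : ∀ {m a} b → 4 * m ≤ m + (m + (a + b)) → b ≤ a → m ≤ a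
  half {m} {a} b size b≤a = *-cancelˡ-≤ 2 (+-cancelˡ-≤ (2 * m) _ _ (begin
    2 * m + 2 * m ≡⟨ *-distribʳ-+ m 2 2 ⟨
    4 * m ≤⟨ size ⟩
    m + (m + (a + b)) ≤⟨ +-monoʳ-≤ m (+-monoʳ-≤ m (+-monoʳ-≤ a b≤a)) ⟩
    m + (m + (a + a)) ≡⟨ solve 2 (λ m a → m :+ (m :+ (a :+ a)) := con 2 :* m :+ con 2 :* a) ≡-refl m a ⟩
    2 * m + 2 * a ∎))
    where open ≤-Reasoning
          open +-*-Solver

  ++-≤ : ∀ (as bs : List X) → length as ≤ length (as ++ bs)
  ++-≤ as bs = ≤-trans (m≤m+n _ (length bs)) (≤-reflexive (sym (length-++ as)))

  rotate : ∀ (as bs cs : List X) → as ++ bs ++ cs ↭ cs ++ as ++ bs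
  rotate as bs cs = trans (↭-reflexive (sym (++-assoc as bs cs))) (++-comm (as ++ bs) cs)

  module SortRun (S : Scale X) where
    open Scale S
    open Run S
    open PivotRun S

    record Divided (k m : ℕ) (xs : List X) (r : List X × List X) : Set where
      constructor divided
      field
        perm : proj₁ r ++ proj₂ r ↭ xs
        m≤L : m ≤ length (proj₁ r)
        m≤G : m ≤ length (proj₂ r)
        L≼G : All (λ l → All (l ≼[ k ]_) (proj₂ r)) (proj₁ r)

    -- The larger of L and G can afford to have its own candidates (lo p or hi p)
    -- redistributed by direct comparison with the pivot.  The other side keeps its candidates
    -- at error j + 1, while all of the larger side is within 1 of the pivot.
    finish-runs : ∀ {j m p r} rest → Central (suc j) m p → 4 * m ≤ length (lo p ++ hi p ++ rest) →
      Split (key p) rest r → Runs m (Divided (suc (suc j)) m (lo p ++ hi p ++ rest)) (finish p r)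
    finish-runs {j} {m} {p} {L , G} rest (central lenLo lenHi lows highs) size (perm , l , g)
      with length G ≤? length L
    ... | yes G≤L = runs-mono (map f (split (key p) (lo p))) (≤-reflexive lenLo) (λ z → z)
          (runs-map (split (key p) (lo p)) (λ {(L′ , G′)} (perm′ , l′ , g′) → divided
            (begin
              (L ++ L′) ++ hi p ++ G ++ G′ ≡⟨ ++-assoc L L′ _ ⟩
              L ++ L′ ++ hi p ++ G ++ G′ ↭⟨ ++⁺ˡ L (++⁺ˡ L′ (rotate (hi p) G G′)) ⟩
              L ++ L′ ++ G′ ++ hi p ++ G ≡⟨ cong (L ++_) (++-assoc L′ G′ _) ⟨
              L ++ (L′ ++ G′) ++ hi p ++ G ↭⟨ ++⁺ˡ L (++⁺ʳ _ perm′) ⟩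
              L ++ lo p ++ hi p ++ G ↭⟨ shifts L (lo p) ⟩
              lo p ++ L ++ hi p ++ G ↭⟨ ++⁺ˡ (lo p) (shifts L (hi p)) ⟩
              lo p ++ hi p ++ L ++ G ↭⟨ ++⁺ˡ (lo p) (++⁺ˡ (hi p) perm) ⟩
              lo p ++ hi p ++ rest ∎)
            (≤-trans (half (length G) size′ G≤L) (++-≤ L L′))
            (≤-trans (≤-reflexive (sym lenHi)) (++-≤ (hi p) (G ++ G′)))
            (cross ≤-refl (All.++⁺ l l′)
              (All.++⁺ highs (All.++⁺ (All.map (≼-mono (s≤s z≤n)) g) (All.map (≼-mono (s≤s z≤n)) g′)))))
          (split-runs (key p) (lo p)))
      where
      open PermutationReasoning
      f = λ ((L′ , G′) : List X × List X) → (L ++ L′ , hi p ++ G ++ G′)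
      size′ = subst (4 * m ≤_) (length-parts (lo p) (hi p) L lenLo lenHi perm) size
    ... | no G≰L = runs-mono (map f (split (key p) (hi p))) (≤-reflexive lenHi) (λ z → z)
          (runs-map (split (key p) (hi p)) (λ {(L′ , G′)} (perm′ , l′ , g′) → divided
            (begin
              (lo p ++ L ++ L′) ++ G ++ G′ ≡⟨ ++-assoc (lo p) (L ++ L′) _ ⟩
              lo p ++ (L ++ L′) ++ G ++ G′ ≡⟨ cong (lo p ++_) (++-assoc L L′ _) ⟩
              lo p ++ L ++ L′ ++ G ++ G′ ↭⟨ ++⁺ˡ (lo p) (++⁺ˡ L (shifts L′ G)) ⟩
              lo p ++ L ++ G ++ L′ ++ G′ ↭⟨ ++⁺ˡ (lo p) (++⁺ˡ L (++⁺ˡ G perm′)) ⟩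
              lo p ++ L ++ G ++ hi p ↭⟨ ++⁺ˡ (lo p) (rotate L G (hi p)) ⟩
              lo p ++ hi p ++ L ++ G ↭⟨ ++⁺ˡ (lo p) (++⁺ˡ (hi p) perm) ⟩
              lo p ++ hi p ++ rest ∎)
            (≤-trans (≤-reflexive (sym lenLo)) (++-≤ (lo p) (L ++ L′)))
            (≤-trans (half (length L) size′ (<⇒≤ (≰⇒> G≰L))) (++-≤ G G′))
            (cross (≤-reflexive (cong suc (+-comm j 1)))
              (All.++⁺ lows (All.++⁺ (All.map (≼-mono (s≤s z≤n)) l) (All.map (≼-mono (s≤s z≤n)) l′)))
              (All.++⁺ g g′)))
          (split-runs (key p) (hi p)))
      where
      open PermutationReasoning
      f = λ ((L′ , G′) : List X × List X) → (lo p ++ L ++ L′ , G ++ G′)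
      size′ = subst (4 * m ≤_) (≡-trans (length-parts (lo p) (hi p) L lenLo lenHi perm)
        (cong (λ z → m + (m + z)) (+-comm (length L) (length G)))) size

    -- With `k = j + 2`, `suc j` levels give candidates of error `k - 1`. The bound on `size`
    -- provides the units, `1 ≤ weight ds` makes both parts shrink, and the last condition feeds
    -- `half`.
    Divisible : ℕ → List ℕ → ℕ → Set
    Divisible j ds N = length ds ≡ suc j × All (1 ≤_) ds × size ds ≤ suc N × 1 ≤ weight ds × 4 * weight ds ≤ N

    partition-runs : ∀ {j ds} xs → Divisible j ds (length xs) →
      Runs (cost ds + length xs) (Divided (suc (suc j)) (weight ds) xs) (partition ds xs)
    partition-runs {j} {ds@(d ∷ ds′)} xs (len , pos , fits , 1≤w , 4w≤N) =
      runs-bind (levels ds P) step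
        (levels-runs⁺ P pos (All.map⁺ (All.universal weak (take q xs))) lenP)
      where
      q = size ds ∸ 1
      P = List.map unit (take q xs)
      lenP : suc (length P) ≡ size ds
      lenP = ≡-trans (cong suc (≡-trans (length-map unit (take q xs))
        (length-take-≤ (s≤s⁻¹ (≤-trans (≤-reflexive (suc-pred-size pos)) fits))))) (suc-pred-size pos)
      weak : ∀ x → Weak 0 1 (unit x)
      weak x = central ≡-refl ≡-refl (≼-refl ∷ []) (≼-refl ∷ []) , ([] , refl) , ([] , refl)
      ground-units : ∀ (ys : List X) → concatMap ground (List.map unit ys) ≡ ys
      ground-units [] = ≡-refl
      ground-units (y ∷ ys) = cong (y ∷_) (ground-units ys)
      step : ∀ {r} → Found (suc (length ds′) + 0) (weight ds * 1) P r →
        Runs (length xs) (Divided (suc (suc j)) (weight ds) xs) (divide xs r)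
      step (p , ≡-refl , c , sub) =
        runs-mono (divide xs (p ∷ [])) bound (λ d → subst-Divided d)
          (runs-bind (split (key p) rest)
            (λ {r} → finish-runs {r = r} rest c′ (≤-trans 4w≤N (≤-reflexive (sym (↭-length whole)))))
            (split-runs (key p) rest))
        where
        rest = xs ∖ (lo p ++ hi p)
        c′ : Central (suc j) (weight ds) p
        c′ = subst₂ (λ j w → Central j w p) (≡-trans (+-identityʳ _) len) (*-identityʳ _) c
        whole : lo p ++ hi p ++ rest ↭ xs
        whole = trans (↭-reflexive (sym (++-assoc (lo p) (hi p) rest)))
          (∖-↭ (⊑-trans sub (subst (_⊑ xs) (sym (ground-units (take q xs)))
            (drop q xs , ↭-reflexive (take++drop≡id q xs)))))
        subst-Divided : ∀ {r} → Divided (suc (suc j)) (weight ds) (lo p ++ hi p ++ rest) r →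
          Divided (suc (suc j)) (weight ds) xs r
        subst-Divided (divided p a b c) = divided (trans p whole) a b c
        -- `rest` lacks both candidate sets and `finish` compares only one of them with the key.
        bound : length rest + weight ds ≤ length xs
        bound = begin
          length rest + weight ds ≡⟨ cong (length rest +_) (Central.lengthLo c′) ⟨
          length rest + length (lo p) ≤⟨ +-monoˡ-≤ (length (lo p)) (m≤n+m (length rest) (length (hi p))) ⟩
          length (hi p) + length rest + length (lo p) ≡⟨ +-comm _ (length (lo p)) ⟩
          length (lo p) + (length (hi p) + length rest) ≡⟨ cong (length (lo p) +_) (length-++ (hi p)) ⟨
          length (lo p) + length (hi p ++ rest) ≡⟨ length-++ (lo p) ⟨
          length (lo p ++ hi p ++ rest) ≡⟨ ↭-length whole ⟩
          length xs ∎
          where open ≤-Reasoning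

    -- All the arithmetic that the sort relies on. `recurrence` ranges over every split that the
    -- adversary can still force.
    record Schedule (j B : ℕ) (D : ℕ → List ℕ) (T : ℕ → ℕ) : Set where
      field
        small : ∀ {N} → N < B → N * N ≤ T N
        divisible : ∀ {N} → B ≤ N → Divisible j (D N) N
        recurrence : ∀ {N M} → B ≤ N + M → weight (D (N + M)) ≤ N → weight (D (N + M)) ≤ M →
          cost (D (N + M)) + (N + M) + (T N + T M) ≤ T (N + M)

    sort-runs : ∀ {j B D T} → Schedule j B D T → ∀ f xs → length xs ≤ f →
      Runs (T (length xs)) (Sorted (suc (suc j)) xs) (sort B D f xs)
    sort-runs sch zero [] _ = refl , []
    sort-runs {j} {B} {D} {T} sch (suc f) xs le with length xs <? B
    ... | yes N<B = runs-mono (quicksort (length xs) xs) (Schedule.small sch N<B) (λ z → z)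
      (quicksort-runs (s≤s (s≤s z≤n)) (length xs) xs ≤-refl)
    ... | no N≮B = runs-mono (partition ds xs >>= conquer (sort B D f)) bound′ (λ z → z)
      (runs-bind (partition ds xs) (λ {r} → step r) (partition-runs xs div))
      where
      open Schedule sch
      ds = D (length xs)
      B≤N : B ≤ length xs
      B≤N = ≮⇒≥ N≮B
      div = divisible B≤N
      budget = T (length xs) ∸ (cost ds + length xs)
      w = weight ds
      spend : ∀ a b → a + b ≡ length xs → w ≤ a → w ≤ b → cost ds + length xs + (T a + T b) ≤ T (length xs)
      spend a b e w≤a w≤b = subst
        (λ N → weight (D N) ≤ a → weight (D N) ≤ b → B ≤ N → cost (D N) + N + (T a + T b) ≤ T N)
        e (λ p q r → recurrence r p q) w≤a w≤b B≤N
      2w≤N : w + w ≤ length xs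
      2w≤N = ≤-trans (+-monoʳ-≤ w (m≤m+n w _)) (proj₂ (proj₂ (proj₂ (proj₂ div))))
      -- `budget` is a truncated subtraction, so the division has to cost at most `T (length xs)`.
      -- This follows from the recurrence for an imaginary split into `w` and the rest.
      bound′ : cost ds + length xs + budget ≤ T (length xs)
      bound′ = ≤-reflexive (m+[n∸m]≡n (m+n≤o⇒m≤o (cost ds + length xs)
        (spend w (length xs ∸ w) (m+[n∸m]≡n (m+n≤o⇒m≤o w 2w≤N)) ≤-refl (m+n≤o⇒m≤o∸n w 2w≤N))))
      step : ∀ r → Divided (suc (suc j)) (weight ds) xs r → Runs budget (Sorted (suc (suc j)) xs) (conquer (sort B D f) r)
      step (L , G) (divided perm m≤L m≤G L≼G) =
        runs-mono (conquer (sort B D f) (L , G)) (m+n≤o⇒m≤o∸n (T (length L) + T (length G)) (≤-trans (≤-reflexive (+-comm _ (cost ds + length xs)))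
          (spend (length L) (length G) lens m≤L m≤G))) (λ z → z)
          (runs-bind (sort B D f L)
            (λ {L′} (pL , sL) → runs-map (sort B D f G) (λ {G′} (pG , sG) →
              trans (++⁺ pL pG) perm ,
              AllPairs.++⁺ sL sG (All.map (All-resp-↭ (↭-sym pG)) (All-resp-↭ (↭-sym pL) L≼G)))
              (sort-runs sch f G (shorter (length L) m≤L (≡-trans (+-comm _ (length L)) lens))))
            (sort-runs sch f L (shorter (length G) m≤G lens)))
        where
        lens : length L + length G ≡ length xs
        lens = ≡-trans (sym (length-++ L)) (↭-length perm)
        shorter : ∀ {a} b → w ≤ b → a + b ≡ length xs → a ≤ f
        shorter {a} b w≤b e = s≤s⁻¹ (≤-trans (≤-trans (≤-reflexive (+-comm 1 a))
          (+-monoʳ-≤ a (≤-trans (proj₁ (proj₂ (proj₂ (proj₂ div)))) w≤b))) (≤-trans (≤-reflexive e) le))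

-- Binary logarithms, iterated halving and the choice of the gaps

1≤2^ : ∀ n → 1 ≤ 2 ^ n
1≤2^ n = m^n>0 2 n

lg : ℕ → ℕ
lg zero = 0
lg (suc N) with 2 ^ suc (lg N) ≤? suc N
... | yes _ = suc (lg N)
... | no _ = lg N

n<2^[1+lg] : ∀ N → N < 2 ^ suc (lg N)
n<2^[1+lg] zero = s≤s z≤n
n<2^[1+lg] (suc N) with 2 ^ suc (lg N) ≤? suc N
... | yes _ = begin-strict
    suc N ≤⟨ n<2^[1+lg] N ⟩
    2 ^ suc (lg N) <⟨ m<m+n _ (1≤2^ (suc (lg N))) ⟩
    2 ^ suc (lg N) + 2 ^ suc (lg N) ≡⟨ cong (2 ^ suc (lg N) +_) (+-identityʳ _) ⟨
    2 ^ suc (suc (lg N)) ∎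
    where open ≤-Reasoning
... | no ≰ = ≰⇒> ≰

2^lg≤n : ∀ N → 2 ^ lg (suc N) ≤ suc N
2^lg≤n N with 2 ^ suc (lg N) ≤? suc N
... | yes le = le
2^lg≤n zero | no _ = s≤s z≤n
2^lg≤n (suc N) | no _ = m≤n⇒m≤1+n (2^lg≤n N)

2^lg≤ : ∀ {N} → 1 ≤ N → 2 ^ lg N ≤ N
2^lg≤ {suc N} _ = 2^lg≤n N

2^-cancel-< : ∀ {m n} → 2 ^ m < 2 ^ n → m < n
2^-cancel-< {m} {n} lt = ≰⇒> λ n≤m → <⇒≱ lt (^-monoʳ-≤ 2 n≤m)

lg-mono : ∀ {m n} → 1 ≤ m → m ≤ n → lg m ≤ lg n
lg-mono {m} {n} 1≤m m≤n = s≤s⁻¹ (2^-cancel-< (≤-<-trans (2^lg≤ 1≤m) (≤-<-trans m≤n (n<2^[1+lg] n))))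

-- This is `⌈t / 2^i⌉`, as rounding up at each halving amounts to rounding up once; `ups-≤` is the
-- half of this that bounds `H`.
ups : ℕ → ℕ → ℕ
ups zero t = t
ups (suc i) t = ⌈ ups i t /2⌉

ups-mono : ∀ i {s t} → s ≤ t → ups i s ≤ ups i t
ups-mono zero le = le
ups-mono (suc i) le = ⌈n/2⌉-mono (ups-mono i le)

1≤ups : ∀ i {t} → 1 ≤ t → 1 ≤ ups i t
1≤ups zero le = le
1≤ups (suc i) le = ⌈n/2⌉-mono (1≤ups i le)

ups-≤ : ∀ i {a t} → t ≤ a * 2 ^ i → ups i t ≤ a
ups-≤ zero {a} le = ≤-trans le (≤-reflexive (*-identityʳ a))
ups-≤ (suc i) {a} {t} le = ≤-trans (⌈n/2⌉-mono (ups-≤ i {a + a} (≤-trans le (≤-reflexive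
  (solve 2 (λ a x → a :* (con 2 :* x) := (a :+ a) :* x) ≡-refl a (2 ^ i))))))
  (≤-reflexive (sym (n≡⌈n+n/2⌉ a)))
  where open +-*-Solver

-- The last level is smaller by a factor 2^(j+1) = 2^(k-1): this makes the costs of the levels
-- decrease geometrically from the first to the last, so that their sum has no factor k.
gaps : ℕ → ℕ → ℕ → List ℕ
gaps j t zero = 2 ^ (⌊ t /2⌋ ∸ suc j) ∷ []
gaps j t (suc i) = 2 ^ ⌊ ups (suc i) t /2⌋ ∷ gaps j t i

gaps-length : ∀ j t i → length (gaps j t i) ≡ suc i
gaps-length j t zero = ≡-refl
gaps-length j t (suc i) = cong suc (gaps-length j t i)

gaps-positive : ∀ j t i → All (1 ≤_) (gaps j t i)
gaps-positive j t zero = 1≤2^ (⌊ t /2⌋ ∸ suc j) ∷ []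
gaps-positive j t (suc i) = 1≤2^ ⌊ ups (suc i) t /2⌋ ∷ gaps-positive j t i

1≤weight : ∀ {ds} → All (1 ≤_) ds → 1 ≤ weight ds
1≤weight [] = s≤s z≤n
1≤weight (p ∷ ps) = *-mono-≤ p (1≤weight ps)

size-weight : ∀ ds → size ds ≡ 2 * (2 ^ length ds * weight ds)
size-weight [] = ≡-refl
size-weight (d ∷ ds) = ≡-trans (cong (2 * d *_) (size-weight ds))
  (solve 3 (λ d x w → con 2 :* d :* (con 2 :* (x :* w)) := con 2 :* (con 2 :* x :* (d :* w))) ≡-refl d (2 ^ length ds) (weight ds))
  where open +-*-Solver

module _ (j t : ℕ) (large : suc j ≤ ⌊ t /2⌋) where
  open +-*-Solver

  -- The exponent `u = ups (suc i) t` splits into `⌊ u /2⌋`, the next gap, and `⌈ u /2⌉`, the next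
  -- `ups`. So a level changes the product only by the factor 2 in `size`. The factor `2 ^ j`
  -- offsets the smaller last level, up to a factor 2.
  gaps-size : ∀ i → size (gaps j t i) * 2 ^ ups (suc i) t * 2 ^ j ≡ 2 ^ (t + suc i)
  gaps-size zero = begin
    2 * 2 ^ e * 2 * 2 ^ ⌈ t /2⌉ * 2 ^ j
      ≡⟨ solve 3 (λ e u j → con 2 :* e :* con 2 :* u :* j := con 2 :* (con 2 :* j :* e :* u)) ≡-refl (2 ^ e) (2 ^ ⌈ t /2⌉) (2 ^ j) ⟩
    2 * (2 ^ suc j * 2 ^ e * 2 ^ ⌈ t /2⌉) ≡⟨ cong (λ z → 2 * (z * 2 ^ ⌈ t /2⌉)) (^-distribˡ-+-* 2 (suc j) e) ⟨
    2 * (2 ^ (suc j + e) * 2 ^ ⌈ t /2⌉) ≡⟨ cong (λ z → 2 * (2 ^ z * 2 ^ ⌈ t /2⌉)) (m+[n∸m]≡n large) ⟩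
    2 * (2 ^ ⌊ t /2⌋ * 2 ^ ⌈ t /2⌉) ≡⟨ cong (2 *_) (^-distribˡ-+-* 2 ⌊ t /2⌋ ⌈ t /2⌉) ⟨
    2 ^ suc (⌊ t /2⌋ + ⌈ t /2⌉) ≡⟨ cong (λ z → 2 ^ suc z) (⌊n/2⌋+⌈n/2⌉≡n t) ⟩
    2 ^ suc t ≡⟨ cong (2 ^_) (+-comm 1 t) ⟩
    2 ^ (t + 1) ∎
    where
    open ≡-Reasoning
    e = ⌊ t /2⌋ ∸ suc j
  gaps-size (suc i) = begin
    2 * 2 ^ ⌊ u /2⌋ * s * 2 ^ ⌈ u /2⌉ * 2 ^ j
      ≡⟨ solve 4 (λ a s b j → con 2 :* a :* s :* b :* j := con 2 :* (s :* (a :* b) :* j)) ≡-refl (2 ^ ⌊ u /2⌋) s (2 ^ ⌈ u /2⌉) (2 ^ j) ⟩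
    2 * (s * (2 ^ ⌊ u /2⌋ * 2 ^ ⌈ u /2⌉) * 2 ^ j) ≡⟨ cong (λ z → 2 * (s * z * 2 ^ j)) (^-distribˡ-+-* 2 ⌊ u /2⌋ ⌈ u /2⌉) ⟨
    2 * (s * 2 ^ (⌊ u /2⌋ + ⌈ u /2⌉) * 2 ^ j) ≡⟨ cong (λ z → 2 * (s * 2 ^ z * 2 ^ j)) (⌊n/2⌋+⌈n/2⌉≡n u) ⟩
    2 * (s * 2 ^ u * 2 ^ j) ≡⟨ cong (2 *_) (gaps-size i) ⟩
    2 ^ suc (t + suc i) ≡⟨ cong (2 ^_) (+-suc t (suc i)) ⟨
    2 ^ (t + suc (suc i)) ∎
    where
    open ≡-Reasoning
    u = ups (suc i) t
    s = size (gaps j t i)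

  -- By `gaps-size`, the level put in front costs no more than the bound for all later levels
  -- together, so the bound doubles with `i`. At `i = j` it makes the cost at most `16 * 2 ^ t`.
  gaps-cost : ∀ i → cost (gaps j t i) * 2 ^ j ≤ 2 ^ (t + (i + 4))
  gaps-cost zero = begin
    (1 * (8 * (2 ^ e * 2 ^ e)) + 0) * 2 ^ j
      ≡⟨ solve 2 (λ e j → (con 1 :* (con 8 :* (e :* e)) :+ con 0) :* j := con 8 :* (j :* e :* e)) ≡-refl (2 ^ e) (2 ^ j) ⟩
    8 * (2 ^ j * 2 ^ e * 2 ^ e) ≤⟨ *-mono-≤ {8} {16} (m≤m+n 8 8) (*-monoˡ-≤ (2 ^ e) (*-monoˡ-≤ (2 ^ e) (m≤m+n (2 ^ j) _))) ⟩
    16 * (2 ^ suc j * 2 ^ e * 2 ^ e) ≡⟨ cong (λ z → 16 * (z * 2 ^ e)) (^-distribˡ-+-* 2 (suc j) e) ⟨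
    16 * (2 ^ (suc j + e) * 2 ^ e) ≡⟨ cong (λ z → 16 * (2 ^ z * 2 ^ e)) (m+[n∸m]≡n large) ⟩
    16 * (2 ^ ⌊ t /2⌋ * 2 ^ e) ≤⟨ *-monoʳ-≤ 16 (*-monoʳ-≤ (2 ^ ⌊ t /2⌋) (^-monoʳ-≤ 2 (≤-trans (m∸n≤m _ (suc j)) (⌊n/2⌋≤⌈n/2⌉ t)))) ⟩
    16 * (2 ^ ⌊ t /2⌋ * 2 ^ ⌈ t /2⌉) ≡⟨ cong (16 *_) (^-distribˡ-+-* 2 ⌊ t /2⌋ ⌈ t /2⌉) ⟨
    16 * 2 ^ (⌊ t /2⌋ + ⌈ t /2⌉) ≡⟨ cong (λ z → 16 * 2 ^ z) (⌊n/2⌋+⌈n/2⌉≡n t) ⟩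
    2 ^ 4 * 2 ^ t ≡⟨ *-comm (2 ^ 4) (2 ^ t) ⟩
    2 ^ t * 2 ^ 4 ≡⟨ ^-distribˡ-+-* 2 t 4 ⟨
    2 ^ (t + 4) ∎
    where
    open ≤-Reasoning
    e = ⌊ t /2⌋ ∸ suc j
  gaps-cost (suc i) = begin
    ((s ∸ 1) * (8 * (h * h)) + e) * 2 ^ j ≤⟨ *-monoˡ-≤ (2 ^ j) (+-monoˡ-≤ e (*-mono-≤ (m∸n≤m s 1) (*-monoʳ-≤ 8 (*-monoʳ-≤ h h≤)))) ⟩
    (s * (8 * (h * 2 ^ ⌈ u /2⌉)) + e) * 2 ^ j ≡⟨ cong (λ z → (s * (8 * z) + e) * 2 ^ j) (^-distribˡ-+-* 2 ⌊ u /2⌋ ⌈ u /2⌉) ⟨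
    (s * (8 * 2 ^ (⌊ u /2⌋ + ⌈ u /2⌉)) + e) * 2 ^ j ≡⟨ cong (λ z → (s * (8 * 2 ^ z) + e) * 2 ^ j) (⌊n/2⌋+⌈n/2⌉≡n u) ⟩
    (s * (8 * 2 ^ u) + e) * 2 ^ j ≡⟨ solve 4 (λ s u e j → (s :* (con 8 :* u) :+ e) :* j := s :* u :* j :* con 8 :+ e :* j) ≡-refl s (2 ^ u) e (2 ^ j) ⟩
    s * 2 ^ u * 2 ^ j * 8 + e * 2 ^ j ≡⟨ cong (λ z → z * 8 + e * 2 ^ j) (gaps-size i) ⟩
    2 ^ (t + suc i) * 2 ^ 3 + e * 2 ^ j ≡⟨ cong (_+ e * 2 ^ j) (^-distribˡ-+-* 2 (t + suc i) 3) ⟨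
    2 ^ (t + suc i + 3) + e * 2 ^ j ≤⟨ +-monoʳ-≤ (2 ^ (t + suc i + 3)) (gaps-cost i) ⟩
    2 ^ (t + suc i + 3) + 2 ^ (t + (i + 4)) ≡⟨ cong (λ z → 2 ^ z + 2 ^ (t + (i + 4))) (solve 2 (λ t i → t :+ (con 1 :+ i) :+ con 3 := t :+ (i :+ con 4)) ≡-refl t i) ⟩
    2 ^ (t + (i + 4)) + 2 ^ (t + (i + 4)) ≡⟨ cong (2 ^ (t + (i + 4)) +_) (+-identityʳ _) ⟨
    2 ^ suc (t + (i + 4)) ≡⟨ cong (2 ^_) (+-suc t (i + 4)) ⟨
    2 ^ (t + (suc i + 4)) ∎
    where
    open ≤-Reasoning
    u = ups (suc i) t
    s = size (gaps j t i)
    e = cost (gaps j t i)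
    h = 2 ^ ⌊ u /2⌋
    h≤ : h ≤ 2 ^ ⌈ u /2⌉
    h≤ = ^-monoʳ-≤ 2 (⌊n/2⌋≤⌈n/2⌉ u)

  -- With `size` expressed through `weight`, `gaps-size` at `i = j` is this equation times
  -- `2 * 2 ^ j`.
  gaps-weight : 2 ^ suc j * weight (gaps j t j) * 2 ^ ups (suc j) t ≡ 2 ^ t
  gaps-weight = *-cancelʳ-≡ _ _ (2 * 2 ^ j) {{m*n≢0 2 (2 ^ j) {{_}} {{m^n≢0 2 j}}}} (begin
    2 ^ suc j * w * v * (2 * 2 ^ j) ≡⟨ solve 4 (λ m w v j → m :* w :* v :* (con 2 :* j) := con 2 :* (m :* w) :* v :* j) ≡-refl (2 ^ suc j) w v (2 ^ j) ⟩
    2 * (2 ^ suc j * w) * v * 2 ^ j ≡⟨ cong (λ z → 2 * (2 ^ z * w) * v * 2 ^ j) (gaps-length j t j) ⟨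
    2 * (2 ^ length ds * w) * v * 2 ^ j ≡⟨ cong (λ z → z * v * 2 ^ j) (size-weight ds) ⟨
    size ds * v * 2 ^ j ≡⟨ gaps-size j ⟩
    2 ^ (t + suc j) ≡⟨ ^-distribˡ-+-* 2 t (suc j) ⟩
    2 ^ t * 2 ^ suc j ∎)
    where
    open ≡-Reasoning
    ds = gaps j t j
    w = weight ds
    v = 2 ^ ups (suc j) t

-- The recurrence for the number of comparisons and its closed bound

^-distrib-* : ∀ m n o → (m * n) ^ o ≡ m ^ o * n ^ o
^-distrib-* m n zero = ≡-refl
^-distrib-* m n (suc o) = ≡-trans (cong (m * n *_) (^-distrib-* m n o))
  (solve 4 (λ m n x y → m :* n :* (x :* y) := m :* x :* (n :* y)) ≡-refl m n (m ^ o) (n ^ o))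
  where open +-*-Solver

module Cost (j : ℕ) where
  open +-*-Solver

  M : ℕ
  M = 2 ^ suc j

  H : ℕ → ℕ
  H zero = 0
  H (suc s) = H s + 2 ^ ups (suc j) (suc s)

  H-mono : ∀ {r s} → r ≤ s → H r ≤ H s
  H-mono {s = zero} z≤n = z≤n
  H-mono {r} {suc s} le with m≤n⇒m<n∨m≡n le
  ... | inj₁ r<s = ≤-trans (H-mono (s≤s⁻¹ r<s)) (m≤m+n _ _)
  ... | inj₂ ≡-refl = ≤-refl

  -- `M * M` pays for quicksort on fewer than `M * M` elements, and `H` has one increment per power
  -- of two. The 9 is half of the 18 in `division-cost`: in `gain` either two terms of `H` pay, or a
  -- single one, which is at least 2.
  g T : ℕ → ℕ
  g N = M * M + 9 * M * H (suc (lg N))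
  T N = N * g N

  g-mono : ∀ {m n} → 1 ≤ m → m ≤ n → g m ≤ g n
  g-mono p q = +-monoʳ-≤ (M * M) (*-monoʳ-≤ (9 * M) (H-mono (s≤s (lg-mono p q))))

  D : ℕ → List ℕ
  D N = gaps j (lg N) j

  module _ {N} (M²≤N : M * M ≤ N) where

    1≤N : 1 ≤ N
    1≤N = ≤-trans (*-mono-≤ (1≤2^ (suc j)) (1≤2^ (suc j))) M²≤N

    -- `M * M` is 2 to the power `2 * suc j`, so the threshold forces `lg N` to be at least this
    -- exponent; hence the subtraction in the last gap is not truncated.
    large : suc j ≤ ⌊ lg N /2⌋
    large = ≤-trans (≤-reflexive (n≡⌊n+n/2⌋ (suc j))) (⌊n/2⌋-mono (s≤s⁻¹ (2^-cancel-<
      (≤-<-trans (≤-reflexive (^-distribˡ-+-* 2 (suc j) (suc j))) (≤-<-trans M²≤N (n<2^[1+lg] N))))))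

    1≤lg : 1 ≤ lg N
    1≤lg = ≤-trans (s≤s z≤n) (≤-trans large (⌊n/2⌋≤n (lg N)))

    2≤2^ups : 2 ≤ 2 ^ ups (suc j) (lg N)
    2≤2^ups = ^-monoʳ-≤ 2 (1≤ups (suc j) 1≤lg)

    2≤M : 2 ≤ M
    2≤M = ^-monoʳ-≤ 2 {1} {suc j} (s≤s z≤n)

    weight-fits : 4 * weight (D N) ≤ N
    weight-fits = begin
      4 * weight (D N) ≡⟨ solve 1 (λ w → con 4 :* w := con 2 :* w :* con 2) ≡-refl (weight (D N)) ⟩
      2 * weight (D N) * 2 ≤⟨ *-mono-≤ (*-monoˡ-≤ (weight (D N)) 2≤M) 2≤2^ups ⟩
      M * weight (D N) * 2 ^ ups (suc j) (lg N) ≡⟨ gaps-weight j (lg N) large ⟩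
      2 ^ lg N ≤⟨ 2^lg≤ 1≤N ⟩
      N ∎
      where open ≤-Reasoning

    size-fits : size (D N) ≤ suc N
    size-fits = begin
      size (D N) ≡⟨ size-weight (D N) ⟩
      2 * (2 ^ length (D N) * weight (D N)) ≡⟨ cong (λ z → 2 * (2 ^ z * weight (D N))) (gaps-length j (lg N) j) ⟩
      2 * (M * weight (D N)) ≡⟨ *-comm 2 (M * weight (D N)) ⟩
      M * weight (D N) * 2 ≤⟨ *-monoʳ-≤ (M * weight (D N)) 2≤2^ups ⟩
      M * weight (D N) * 2 ^ ups (suc j) (lg N) ≡⟨ gaps-weight j (lg N) large ⟩
      2 ^ lg N ≤⟨ 2^lg≤ 1≤N ⟩
      N ≤⟨ n≤1+n N ⟩
      suc N ∎
      where open ≤-Reasoning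

    division-cost : cost (D N) + N ≤ 18 * 2 ^ lg N
    division-cost = begin
      cost (D N) + N ≤⟨ +-mono-≤ cost≤ (<⇒≤ (n<2^[1+lg] N)) ⟩
      16 * 2 ^ lg N + 2 * 2 ^ lg N ≡⟨ *-distribʳ-+ (2 ^ lg N) 16 2 ⟨
      18 * 2 ^ lg N ∎
      where
      open ≤-Reasoning
      cost≤ : cost (D N) ≤ 16 * 2 ^ lg N
      cost≤ = *-cancelʳ-≤ _ _ (2 ^ j) {{m^n≢0 2 j}} (begin
        cost (D N) * 2 ^ j ≤⟨ gaps-cost j (lg N) large j ⟩
        2 ^ (lg N + (j + 4)) ≡⟨ ^-distribˡ-+-* 2 (lg N) (j + 4) ⟩
        2 ^ lg N * 2 ^ (j + 4) ≡⟨ cong (2 ^ lg N *_) (^-distribˡ-+-* 2 j 4) ⟩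
        2 ^ lg N * (2 ^ j * 16) ≡⟨ solve 2 (λ x y → x :* (y :* con 16) := con 16 :* x :* y) ≡-refl (2 ^ lg N) (2 ^ j) ⟩
        16 * 2 ^ lg N * 2 ^ j ∎)

    -- The smaller side a pays for the whole division.  If a spans half of N the last
    -- term of H pays; otherwise the last two terms pay, since a ≥ weight (D N).
    gain : ∀ {a} → 1 ≤ a → weight (D N) ≤ a → a + a ≤ N → 18 * 2 ^ lg N + a * g a ≤ a * g N
    gain {a} 1≤a w≤a 2a≤N = go (lg N) ≡-refl
      where
      open ≤-Reasoning
      lga<lgN : lg a < lg N
      lga<lgN = s≤s⁻¹ (2^-cancel-< (begin-strict
        2 ^ suc (lg a) ≡⟨ cong (2 ^ lg a +_) (+-identityʳ _) ⟩
        2 ^ lg a + 2 ^ lg a ≤⟨ +-mono-≤ (2^lg≤ 1≤a) (2^lg≤ 1≤a) ⟩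
        a + a ≤⟨ 2a≤N ⟩
        N <⟨ n<2^[1+lg] N ⟩
        2 ^ suc (lg N) ∎))
      lift : ∀ {x} → H (suc (lg a)) + x ≤ H (suc (lg N)) → 18 * 2 ^ lg N ≤ a * (9 * M * x) →
        18 * 2 ^ lg N + a * g a ≤ a * g N
      lift {x} h b = begin
        18 * 2 ^ lg N + a * g a ≤⟨ +-monoˡ-≤ (a * g a) b ⟩
        a * (9 * M * x) + a * g a ≡⟨ solve 5 (λ a n x m h → a :* (n :* x) :+ a :* (m :+ n :* h) := a :* (m :+ n :* (h :+ x))) ≡-refl a (9 * M) x (M * M) (H (suc (lg a))) ⟩
        a * (M * M + 9 * M * (H (suc (lg a)) + x)) ≤⟨ *-monoʳ-≤ a (+-monoʳ-≤ (M * M) (*-monoʳ-≤ (9 * M) h)) ⟩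
        a * g N ∎
      go : ∀ t → lg N ≡ t → 18 * 2 ^ lg N + a * g a ≤ a * g N
      go zero e = contradiction (subst (lg a <_) e lga<lgN) λ ()
      go (suc t) e with m≤n⇒m<n∨m≡n (s≤s⁻¹ (subst (lg a <_) e lga<lgN))
      ... | inj₂ lga≡t = lift {2}
        (≤-trans (+-monoʳ-≤ _ (^-monoʳ-≤ 2 (1≤ups (suc j) (s≤s z≤n))))
          (≤-reflexive (cong (λ z → H (suc z)) (≡-trans (cong suc lga≡t) (sym e)))))
        (begin
          18 * 2 ^ lg N ≡⟨ cong (λ z → 18 * 2 ^ z) e ⟩
          18 * (2 * 2 ^ t) ≡⟨ cong (λ z → 18 * (2 * 2 ^ z)) lga≡t ⟨
          18 * (2 * 2 ^ lg a) ≤⟨ *-monoʳ-≤ 18 (*-mono-≤ 2≤M (2^lg≤ 1≤a)) ⟩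
          18 * (M * a) ≡⟨ solve 2 (λ m a → con 18 :* (m :* a) := a :* (con 9 :* m :* con 2)) ≡-refl M a ⟩
          a * (9 * M * 2) ∎)
      ... | inj₁ lga<t = lift {v + v}
        (begin
          H (suc (lg a)) + (v + v) ≤⟨ +-mono-≤ (H-mono lga<t) (+-monoʳ-≤ v (^-monoʳ-≤ 2 (ups-mono (suc j) (n≤1+n (lg N))))) ⟩
          H t + (v + 2 ^ ups (suc j) (suc (lg N))) ≡⟨ +-assoc (H t) v _ ⟨
          H t + v + 2 ^ ups (suc j) (suc (lg N)) ≡⟨ cong (λ z → H t + 2 ^ ups (suc j) z + 2 ^ ups (suc j) (suc (lg N))) e ⟩
          H (suc t) + 2 ^ ups (suc j) (suc (lg N)) ≡⟨ cong (λ z → H z + 2 ^ ups (suc j) (suc (lg N))) e ⟨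
          H (suc (lg N)) ∎)
        (begin
          18 * 2 ^ lg N ≡⟨ cong (18 *_) (gaps-weight j (lg N) large) ⟨
          18 * (M * weight (D N) * v) ≤⟨ *-monoʳ-≤ 18 (*-monoˡ-≤ v (*-monoʳ-≤ M w≤a)) ⟩
          18 * (M * a * v) ≡⟨ solve 3 (λ m a v → con 18 :* (m :* a :* v) := a :* (con 9 :* m :* (v :+ v))) ≡-refl M a v ⟩
          a * (9 * M * (v + v)) ∎)
        where
        v = 2 ^ ups (suc j) (lg N)

  recurrence : ∀ {a b} → M * M ≤ a + b → weight (D (a + b)) ≤ a → weight (D (a + b)) ≤ b →
    cost (D (a + b)) + (a + b) + (T a + T b) ≤ T (a + b)
  recurrence {a} {b} M²≤ w≤a w≤b = begin
    cost (D (a + b)) + (a + b) + (T a + T b) ≤⟨ +-monoˡ-≤ _ (division-cost M²≤) ⟩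
    18 * 2 ^ lg (a + b) + (T a + T b) ≤⟨ sides (≤-total a b) ⟩
    a * g (a + b) + b * g (a + b) ≡⟨ *-distribʳ-+ (g (a + b)) a b ⟨
    T (a + b) ∎
    where
    open ≤-Reasoning
    1≤w : 1 ≤ weight (D (a + b))
    1≤w = 1≤weight (gaps-positive j (lg (a + b)) j)
    1≤a = ≤-trans 1≤w w≤a
    1≤b = ≤-trans 1≤w w≤b
    e = 18 * 2 ^ lg (a + b)
    -- `gain` charges the smaller side; for the larger one the monotonicity of `g` is enough.
    sides : a ≤ b ⊎ b ≤ a → e + (T a + T b) ≤ a * g (a + b) + b * g (a + b)
    sides (inj₁ a≤b) = begin
      e + (T a + T b) ≡⟨ +-assoc e (T a) (T b) ⟨
      e + T a + T b ≤⟨ +-mono-≤ (gain M²≤ 1≤a w≤a (+-monoʳ-≤ a a≤b)) (*-monoʳ-≤ b (g-mono 1≤b (m≤n+m b a))) ⟩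
      a * g (a + b) + b * g (a + b) ∎
    sides (inj₂ b≤a) = begin
      e + (T a + T b) ≡⟨ solve 3 (λ e x y → e :+ (x :+ y) := x :+ (e :+ y)) ≡-refl e (T a) (T b) ⟩
      T a + (e + T b) ≤⟨ +-mono-≤ (*-monoʳ-≤ a (g-mono 1≤a (m≤m+n a b))) (gain M²≤ 1≤b w≤b (+-monoˡ-≤ b b≤a)) ⟩
      a * g (a + b) + b * g (a + b) ∎

  -- From `a * M + 1` to `a * M + M` the terms of `H` are at most `2 ^ suc a`, hence the linear
  -- growth in `r`. At `r = M` the bound agrees with the next block's at `r = 0`; the summand
  -- `2 * M` makes it an equality at the start.
  H-bound : ∀ a r → r ≤ M → H (a * M + r) + 2 * M ≤ 2 ^ suc a * (M + r)
  H-bound zero zero _ = ≤-reflexive (cong (2 *_) (sym (+-identityʳ M)))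
  H-bound (suc a) zero _ = begin
    H (M + a * M + 0) + 2 * M ≡⟨ cong (λ z → H z + 2 * M) (≡-trans (+-identityʳ _) (+-comm M _)) ⟩
    H (a * M + M) + 2 * M ≤⟨ H-bound a M ≤-refl ⟩
    2 ^ suc a * (M + M) ≡⟨ solve 2 (λ x m → x :* (m :+ m) := con 2 :* x :* (m :+ con 0)) ≡-refl (2 ^ suc a) M ⟩
    2 ^ suc (suc a) * (M + 0) ∎
    where open ≤-Reasoning
  H-bound a (suc r) r<M = begin
    H (a * M + suc r) + 2 * M ≡⟨ cong (λ z → H z + 2 * M) (+-suc (a * M) r) ⟩
    H (a * M + r) + 2 ^ ups (suc j) (suc (a * M + r)) + 2 * M
      ≤⟨ +-monoˡ-≤ (2 * M) (+-monoʳ-≤ (H (a * M + r)) (^-monoʳ-≤ 2 (ups-≤ (suc j) {suc a}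
           (≤-trans (≤-reflexive (sym (+-suc (a * M) r))) (≤-trans (+-monoʳ-≤ (a * M) r<M) (≤-reflexive (+-comm (a * M) M))))))) ⟩
    H (a * M + r) + x + 2 * M ≡⟨ solve 3 (λ h x m → h :+ x :+ m := h :+ m :+ x) ≡-refl (H (a * M + r)) x (2 * M) ⟩
    H (a * M + r) + 2 * M + x ≤⟨ +-monoˡ-≤ x (H-bound a r (<⇒≤ r<M)) ⟩
    x * (M + r) + x ≡⟨ solve 3 (λ x m r → x :* (m :+ r) :+ x := x :* (m :+ (con 1 :+ r))) ≡-refl x M r ⟩
    x * (M + suc r) ∎
    where
    open ≤-Reasoning
    x = 2 ^ suc a

  -- 18 (1 + (θ + 1)/M) is at most 27 for θ + 1 ≤ M/2, and at most 36 < 28 √2 otherwise.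
  constants : ∀ θ → θ < M → (18 * (M + suc θ)) ^ M ≤ (28 * M) ^ M * 2 ^ θ
  constants θ θ<M with suc θ ≤? 2 ^ j
  ... | yes small = begin
    (18 * (M + suc θ)) ^ M ≤⟨ ^-monoˡ-≤ M (begin
      18 * (M + suc θ) ≤⟨ *-monoʳ-≤ 18 (+-monoʳ-≤ M small) ⟩
      18 * (2 * 2 ^ j + 2 ^ j) ≡⟨ solve 1 (λ x → con 18 :* (con 2 :* x :+ x) := con 54 :* x) ≡-refl (2 ^ j) ⟩
      54 * 2 ^ j ≤⟨ *-monoˡ-≤ (2 ^ j) {54} {56} (m≤m+n 54 2) ⟩
      56 * 2 ^ j ≡⟨ solve 1 (λ x → con 56 :* x := con 28 :* (con 2 :* x)) ≡-refl (2 ^ j) ⟩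
      28 * M ∎) ⟩
    (28 * M) ^ M ≡⟨ *-identityʳ _ ⟨
    (28 * M) ^ M * 1 ≤⟨ *-monoʳ-≤ ((28 * M) ^ M) (1≤2^ θ) ⟩
    (28 * M) ^ M * 2 ^ θ ∎
    where open ≤-Reasoning
  ... | no ≰ = begin
    (18 * (M + suc θ)) ^ M ≤⟨ ^-monoˡ-≤ M (*-monoʳ-≤ 18 (+-monoʳ-≤ M θ<M)) ⟩
    (18 * (M + M)) ^ M ≡⟨ cong (_^ M) (solve 1 (λ m → con 18 :* (m :+ m) := con 36 :* m) ≡-refl M) ⟩
    (36 * M) ^ M ≡⟨ ^-distrib-* 36 M M ⟩
    36 ^ M * M ^ M ≡⟨ cong (_* M ^ M) (^-*-assoc 36 2 (2 ^ j)) ⟨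
    1296 ^ 2 ^ j * M ^ M ≤⟨ *-monoˡ-≤ (M ^ M) (^-monoˡ-≤ (2 ^ j) {1296} {784 * 2} (m≤m+n 1296 272)) ⟩
    (784 * 2) ^ 2 ^ j * M ^ M ≡⟨ cong (_* M ^ M) (^-distrib-* 784 2 (2 ^ j)) ⟩
    784 ^ 2 ^ j * 2 ^ 2 ^ j * M ^ M ≡⟨ cong (λ z → z * 2 ^ 2 ^ j * M ^ M) (^-*-assoc 28 2 (2 ^ j)) ⟩
    28 ^ M * 2 ^ 2 ^ j * M ^ M ≤⟨ *-monoˡ-≤ (M ^ M) (*-monoʳ-≤ (28 ^ M) (^-monoʳ-≤ 2 (s≤s⁻¹ (≰⇒> ≰)))) ⟩
    28 ^ M * 2 ^ θ * M ^ M ≡⟨ solve 3 (λ x y z → x :* y :* z := x :* z :* y) ≡-refl (28 ^ M) (2 ^ θ) (M ^ M) ⟩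
    28 ^ M * M ^ M * 2 ^ θ ≡⟨ cong (_* 2 ^ θ) (^-distrib-* 28 M M) ⟨
    (28 * M) ^ M * 2 ^ θ ∎
    where open ≤-Reasoning

  -- With `lg n = a * M + θ`, the `M`-th power turns the factor `2 ^ a` into `2 ^ (a * M)`, and
  -- `constants` contributes the missing `2 ^ θ`; their product is `2 ^ lg n`.
  T-bound : ∀ n → 1 ≤ n → T n ^ M ≤ (28 * (M * M) * n) ^ M * n
  T-bound n 1≤n = begin
    T n ^ M ≤⟨ ^-monoˡ-≤ M (*-monoʳ-≤ n g≤) ⟩
    (n * (M * 2 ^ a * (18 * (M + suc θ)))) ^ M ≡⟨ cong (_^ M) (*-assoc n (M * 2 ^ a) _) ⟨
    (n * (M * 2 ^ a) * (18 * (M + suc θ))) ^ M ≡⟨ ^-distrib-* (n * (M * 2 ^ a)) _ M ⟩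
    (n * (M * 2 ^ a)) ^ M * (18 * (M + suc θ)) ^ M ≤⟨ *-monoʳ-≤ ((n * (M * 2 ^ a)) ^ M) (constants θ (m%n<n (lg n) M)) ⟩
    (n * (M * 2 ^ a)) ^ M * ((28 * M) ^ M * 2 ^ θ) ≡⟨ *-assoc ((n * (M * 2 ^ a)) ^ M) _ _ ⟨
    (n * (M * 2 ^ a)) ^ M * (28 * M) ^ M * 2 ^ θ ≡⟨ cong (_* 2 ^ θ) (^-distrib-* (n * (M * 2 ^ a)) (28 * M) M) ⟨
    (n * (M * 2 ^ a) * (28 * M)) ^ M * 2 ^ θ ≡⟨ cong (λ z → z ^ M * 2 ^ θ) (solve 3 (λ n m x → n :* (m :* x) :* (con 28 :* m) := con 28 :* (m :* m) :* n :* x) ≡-refl n M (2 ^ a)) ⟩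
    (28 * (M * M) * n * 2 ^ a) ^ M * 2 ^ θ ≡⟨ cong (_* 2 ^ θ) (^-distrib-* (28 * (M * M) * n) (2 ^ a) M) ⟩
    (28 * (M * M) * n) ^ M * (2 ^ a) ^ M * 2 ^ θ ≡⟨ *-assoc ((28 * (M * M) * n) ^ M) _ _ ⟩
    (28 * (M * M) * n) ^ M * ((2 ^ a) ^ M * 2 ^ θ) ≡⟨ cong (λ z → (28 * (M * M) * n) ^ M * (z * 2 ^ θ)) (^-*-assoc 2 a M) ⟩
    (28 * (M * M) * n) ^ M * (2 ^ (a * M) * 2 ^ θ) ≡⟨ cong ((28 * (M * M) * n) ^ M *_) (^-distribˡ-+-* 2 (a * M) θ) ⟨
    (28 * (M * M) * n) ^ M * 2 ^ (a * M + θ) ≡⟨ cong (λ z → (28 * (M * M) * n) ^ M * 2 ^ z) lg≡ ⟨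
    (28 * (M * M) * n) ^ M * 2 ^ lg n ≤⟨ *-monoʳ-≤ ((28 * (M * M) * n) ^ M) (2^lg≤ 1≤n) ⟩
    (28 * (M * M) * n) ^ M * n ∎
    where
    open ≤-Reasoning
    instance
      M≢0 : NonZero M
      M≢0 = m^n≢0 2 (suc j)
    a = lg n / M
    θ = lg n % M
    lg≡ : lg n ≡ a * M + θ
    lg≡ = ≡-trans (m≡m%n+[m/n]*n (lg n) M) (+-comm θ _)
    g≤ : g n ≤ M * 2 ^ a * (18 * (M + suc θ))
    g≤ = begin
      -- `18 * (M * M)` is `9 * M` times the `2 * M` that `H-bound` absorbs.
      M * M + 9 * M * h ≤⟨ +-monoˡ-≤ (9 * M * h) (m≤m+n (M * M) (17 * (M * M))) ⟩
      18 * (M * M) + 9 * M * h ≡⟨ solve 2 (λ m h → con 18 :* (m :* m) :+ con 9 :* m :* h := con 9 :* m :* (h :+ con 2 :* m)) ≡-refl M h ⟩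
      9 * M * (h + 2 * M) ≡⟨ cong (λ z → 9 * M * (H z + 2 * M)) (≡-trans (cong suc lg≡) (sym (+-suc (a * M) θ))) ⟩
      9 * M * (H (a * M + suc θ) + 2 * M) ≤⟨ *-monoʳ-≤ (9 * M) (H-bound a (suc θ) (m%n<n (lg n) M)) ⟩
      9 * M * (2 ^ suc a * (M + suc θ)) ≡⟨ solve 3 (λ m x y → con 9 :* m :* (con 2 :* x :* y) := m :* x :* (con 18 :* y)) ≡-refl M (2 ^ a) (M + suc θ) ⟩
      M * 2 ^ a * (18 * (M + suc θ)) ∎
      where h = H (suc (lg n))

  module _ {X : Set} (_≟_ : DecidableEquality X) (S : Scale X) where
    open Sort _≟_
    open SortRun S

    schedule : Schedule j (M * M) D T
    schedule = record
      { small = λ {N} N<M² → *-monoʳ-≤ N (≤-trans (<⇒≤ N<M²) (m≤m+n (M * M) _))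
      ; divisible = λ {N} M²≤N → gaps-length j (lg N) j , gaps-positive j (lg N) j , size-fits M²≤N ,
          1≤weight (gaps-positive j (lg N) j) , weight-fits M²≤N
      ; recurrence = recurrence
      }

-- Rational values, orderings and decision trees

ℕ→ℚ-homo-+ : ∀ d e → ℕ→ℚ (d + e) ≡ ℕ→ℚ d ℚ.+ ℕ→ℚ e
ℕ→ℚ-homo-+ d e = ℚ.toℚᵘ-injective (begin
  ℚ.toℚᵘ (ℕ→ℚ (d + e)) ≈⟨ ℚ.toℚᵘ-fromℚᵘ (whole (d + e)) ⟩
  whole (d + e) ≈⟨ ℚᵘ.*≡* (cong (ℤ._* ℤ.+ 1) (≡-trans (ℤ.pos-+ d e) (sym (cong₂ ℤ._+_ (ℤ.*-identityʳ (ℤ.+ d)) (ℤ.*-identityʳ (ℤ.+ e)))))) ⟩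
  whole d ℚᵘ.+ whole e ≈⟨ ℚᵘ.+-cong (ℚ.toℚᵘ-fromℚᵘ (whole d)) (ℚ.toℚᵘ-fromℚᵘ (whole e)) ⟨
  ℚ.toℚᵘ (ℕ→ℚ d) ℚᵘ.+ ℚ.toℚᵘ (ℕ→ℚ e) ≈⟨ ℚ.toℚᵘ-homo-+ (ℕ→ℚ d) (ℕ→ℚ e) ⟨
  ℚ.toℚᵘ (ℕ→ℚ d ℚ.+ ℕ→ℚ e) ∎)
  where
  open ℚᵘ.≃-Reasoning
  whole : ℕ → ℚᵘ.ℚᵘ
  whole n = ℚᵘ.mkℚᵘ (ℤ.+ n) 0

x≤x+ℕ : ∀ x e → x ℚ.≤ x ℚ.+ ℕ→ℚ e
x≤x+ℕ x e = subst (ℚ._≤ x ℚ.+ ℕ→ℚ e) (ℚ.+-identityʳ x)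
  (ℚ.+-monoʳ-≤ x (ℚ.nonNegative⁻¹ (ℕ→ℚ e) {{ℚ.normalize-nonNeg e 1}}))

module _ {n} (val : Fin n → ℚ) where

  within : Scale (Fin n)
  within = record
    { _≼[_]_ = λ x e y → val x ℚ.≤ val y ℚ.+ ℕ→ℚ e
    ; ≼-refl = λ {x} → x≤x+ℕ (val x) 0
    ; ≼-trans = λ {x} {y} {z} {d} {e} p q → begin
        val x ≤⟨ p ⟩
        val y ℚ.+ ℕ→ℚ d ≤⟨ ℚ.+-monoˡ-≤ (ℕ→ℚ d) q ⟩
        val z ℚ.+ ℕ→ℚ e ℚ.+ ℕ→ℚ d ≡⟨ ℚ.+-assoc (val z) _ _ ⟩
        val z ℚ.+ (ℕ→ℚ e ℚ.+ ℕ→ℚ d) ≡⟨ cong (val z ℚ.+_) (≡-trans (sym (ℕ→ℚ-homo-+ e d)) (cong ℕ→ℚ (+-comm e d))) ⟩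
        val z ℚ.+ ℕ→ℚ (d + e) ∎
    ; ≼-mono = λ {x} {y} {d} {e} d≤e p → begin
        val x ≤⟨ p ⟩
        val y ℚ.+ ℕ→ℚ d ≤⟨ x≤x+ℕ (val y ℚ.+ ℕ→ℚ d) (e ∸ d) ⟩
        val y ℚ.+ ℕ→ℚ d ℚ.+ ℕ→ℚ (e ∸ d) ≡⟨ ℚ.+-assoc (val y) _ _ ⟩
        val y ℚ.+ (ℕ→ℚ d ℚ.+ ℕ→ℚ (e ∸ d)) ≡⟨ cong (val y ℚ.+_) (≡-trans (sym (ℕ→ℚ-homo-+ d (e ∸ d))) (cong ℕ→ℚ (m+[n∸m]≡n d≤e))) ⟩
        val y ℚ.+ ℕ→ℚ e ∎
    }
    where open ℚ.≤-Reasoning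

-- Every answer is consistent with this scale, so a run over it visits every leaf.
anything : ∀ {X} → Scale X
anything = record { _≼[_]_ = λ _ _ _ → ⊤ ; ≼-refl = tt ; ≼-trans = λ _ _ → tt ; ≼-mono = λ _ _ → tt }

AllPairs-lookup : ∀ {A : Set} {R : A → A → Set} {xs} → AllPairs R xs → ∀ i j → toℕ i < toℕ j →
  R (lookup xs i) (lookup xs j)
AllPairs-lookup (r ∷ rs) fzero (fsuc j) _ = All.lookup r (∈-lookup j)
AllPairs-lookup (r ∷ rs) (fsuc i) (fsuc j) i<j = AllPairs-lookup rs i j (s≤s⁻¹ i<j)

module _ {n} {zs : List (Fin n)} (p : zs ↭ allFin n) where

  length≡ : length (allFin n) ≡ n
  length≡ = length-tabulate {n = n} (λ i → i)

  length-zs : n ≡ length zs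
  length-zs = ≡-trans (sym length≡) (sym (↭-length p))

  ordering : Permutation′ n
  ordering = cast-id length-zs ∘ₚ onIndices (↭⇒↭ₛ p) ∘ₚ cast-id length≡

  ordering-lookup : ∀ i → ordering ⟨$⟩ʳ i ≡ lookup zs (cast length-zs i)
  ordering-lookup i = begin
    cast length≡ i″ ≡⟨ lookup-tabulate (λ i → i) _ ⟨
    lookup (allFin n) (cast (sym length≡) (cast length≡ i″)) ≡⟨ cong (lookup (allFin n)) (Fin.cast-involutive (sym length≡) length≡ i″) ⟩
    lookup (allFin n) i″ ≡⟨ onIndices-lookup (setoid (Fin n)) (↭⇒↭ₛ p) i′ ⟨
    lookup zs i′ ∎
    where
    open ≡-Reasoning
    i′ = cast length-zs i
    i″ = onIndices (↭⇒↭ₛ p) ⟨$⟩ʳ i′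

open Run using (Runs)

-- Every leaf must hold a permutation, even one that no `val` reaches, and the tree must be the same
-- for all `val`. The run over `anything` supplies these permutations without mentioning `val`.
decisionTree : ∀ {n b} (p : Prog (Fin n) (List (Fin n))) → Runs anything b (_↭ allFin n) p → Alg n
decisionTree (ret zs) perm = leaf (ordering perm)
decisionTree {b = suc b} (ask i j l r) (ql , qr) =
  query i j (decisionTree l (ql tt)) (decisionTree r (qr tt))

decisionTree-sorts : ∀ {n a b k} (val : Fin n → ℚ) (p : Prog (Fin n) (List (Fin n)))
  (perm : Runs anything a (_↭ allFin n) p) →
  Runs (within val) b (AllPairs (λ x y → val x ℚ.≤ val y ℚ.+ ℕ→ℚ k)) p →
  SortsWithin val k b (decisionTree p perm)
decisionTree-sorts {k = k} val (ret zs) perm sorted i j j<i = begin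
  val (π ⟨$⟩ʳ j) ℚ.- ℕ→ℚ k ≤⟨ ℚ.+-monoˡ-≤ (ℚ.- ℕ→ℚ k) ordered ⟩
  val (π ⟨$⟩ʳ i) ℚ.+ ℕ→ℚ k ℚ.- ℕ→ℚ k ≡⟨ ℚ.+-assoc (val (π ⟨$⟩ʳ i)) _ _ ⟩
  val (π ⟨$⟩ʳ i) ℚ.+ (ℕ→ℚ k ℚ.- ℕ→ℚ k) ≡⟨ cong (val (π ⟨$⟩ʳ i) ℚ.+_) (ℚ.+-inverseʳ (ℕ→ℚ k)) ⟩
  val (π ⟨$⟩ʳ i) ℚ.+ ℚ.0ℚ ≡⟨ ℚ.+-identityʳ _ ⟩
  val (π ⟨$⟩ʳ i) ∎
  where
  open ℚ.≤-Reasoning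
  π = ordering perm
  ordered : val (π ⟨$⟩ʳ j) ℚ.≤ val (π ⟨$⟩ʳ i) ℚ.+ ℕ→ℚ k
  ordered = subst₂ (λ x y → val x ℚ.≤ val y ℚ.+ ℕ→ℚ k)
    (sym (ordering-lookup perm j)) (sym (ordering-lookup perm i))
    (AllPairs-lookup sorted _ _ (subst₂ _<_ (sym (Fin.toℕ-cast _ j)) (sym (Fin.toℕ-cast _ i)) j<i))
decisionTree-sorts {a = suc a} {suc b} val (ask i j l r) (pl , pr) (ql , qr) =
  (λ c → decisionTree-sorts val l (pl tt) (ql (ℚ.≮⇒≥ c))) ,
  (λ c → decisionTree-sorts val r (pr tt) (qr (ℚ.≮⇒≥ c)))

theorem12 : (n k : ℕ) → 2 ≤ k → 2 ^ (2 ^ k) ≤ n →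
    Σ (Alg n) λ T → Σ ℕ λ C →
    WithinBound n k C × ((val : Fin n → ℚ) → SortsWithin val k C T)
theorem12 n (suc (suc j)) (s≤s (s≤s _)) 2^2^k≤n =
  decisionTree program (runs anything proj₁) , T n , bound ,
  λ val → decisionTree-sorts val program (runs anything proj₁) (runs (within val) proj₂)
  where
  open Cost j
  open Sort Fin._≟_ using (sort)
  program = sort (M * M) D n (allFin n)
  runs : (S : Scale (Fin n)) {Q : List (Fin n) → Set} →
    (∀ {zs} → Run.Sorted S (suc (suc j)) (allFin n) zs → Q zs) → Runs S (T n) Q program
  runs S h = Run.runs-mono S program (≤-reflexive (cong T (length-tabulate {n = n} (λ i → i)))) h
    (Sort.SortRun.sort-runs Fin._≟_ S (schedule Fin._≟_ S) n (allFin n)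
      (≤-reflexive (length-tabulate {n = n} (λ i → i))))
  bound : WithinBound n (suc (suc j)) (T n)
  bound = begin
    (T n ∸ n * c n) ^ M ≤⟨ ^-monoˡ-≤ M (m∸n≤m (T n) (n * c n)) ⟩
    T n ^ M ≤⟨ T-bound n (≤-trans (1≤2^ (2 ^ suc (suc j))) 2^2^k≤n) ⟩
    (28 * (M * M) * n) ^ M * n ≡⟨ cong (λ z → (z * n) ^ M * n) 28M²≡7*4^k ⟩
    (7 * 4 ^ suc (suc j) * n) ^ M * n ∎
    where
    open ≤-Reasoning
    -- `M * M` is `4 ^ suc j`, and the factor 4 in 28 raises the exponent to `k`.
    28M²≡7*4^k : 28 * (M * M) ≡ 7 * 4 ^ suc (suc j)
    28M²≡7*4^k = ≡-trans (cong (28 *_) (sym (^-distrib-* 2 2 (suc j)))) (*-assoc 7 4 (4 ^ suc j))
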